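{- Let $(W,S)$ be a finite Coxeter system with $S=\{s_1,\ldots,s_n\}$ (any ordering of $S$), and for $0\le k\le n$ let $I_k=\{s_1,\ldots,s_k\}$. For $1\le k\le n$ let ${}^{I_{k-1}}(W_{I_k})$ be the set of minimal length representatives of the cosets $W_{I_{k-1}}\backslash W_{I_k}$, and let $\prec$ be a linear ordering on ${}^{I_{k-1}}(W_{I_k})$ extending the weak order. Let $u,w\in W$, and for $0\le k\le n$ let $u_k, w_k\in W_{I_k}$ be the parabolic projections of $u$ and $w$ to $W_{I_k}$. Define $j_0=e$ and, recursively for $1\le k\le n$, $j_k=j_{k-1}z_k$, where $z_k$ is the minimal element with respect to $\prec$ among those $z\in{}^{I_{k-1}}(W_{I_k})$ such that $u_k\le j_{k-1}z$ and $w_k\le j_{k-1}z$. Then this recursion correctly computes the join in weak order: each $z_k$ exists, $j_k$ is the parabolic projection of $u\vee w$ to $W_{I_k}$ for each $k$, and $j_n=u\vee w$.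
   Context: Let $\ell$ be the length function of $(W,S)$, $\Phi$ its root system, $\Phi^+$ the positive roots, $\Phi^-=-\Phi^+$, and $\Phi_w=\Phi^+\cap w(\Phi^-)$ for $w\in W$. The (right) weak order on $W$ is defined by $u\le w$ iff $\Phi_u\subseteq\Phi_w$; since $W$ is finite it is a lattice with join $\vee$. For $I\subseteq S$, $W_I$ is the standard parabolic subgroup generated by $I$. For $I\subseteq J\subseteq S$ set ${}^I(W_J)=\{w\in W_J\mid \ell(sw)>\ell(w)\text{ for all }s\in I\}$. Each $w\in W$ factors uniquely as $w=w_I\,{}^Iw$ with $w_I\in W_I$ and ${}^Iw\in{}^I(W_S)={}^IW$; the parabolic projection of $w$ to $W_I$ is $w_I$. -}

module Defs where

open import Level using (Level; _⊔_) renaming (zero to 0ℓ; suc to lsuc)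
open import Algebra.Bundles using (Group; CommutativeRing)
open import Data.Empty using (⊥-elim)
open import Data.Nat.Base as ℕ using (ℕ; zero; suc; z≤n; s≤s)
open import Data.Fin.Base using (Fin; zero; suc; toℕ; inject₁)
open import Data.Fin.Properties using (any?) renaming (_≟_ to _≟ᶠ_)
open import Data.List.Base using (List; []; _∷_; _++_; concat; foldr; length; replicate)
open import Data.Product.Base using (Σ; ∃; ∃-syntax; Σ-syntax; _×_; _,_; proj₁; proj₂)
open import Data.Vec.Functional using (Vector)
open import Function.Base using (_∘_; _on_)
open import Function.Bundles using (Inverse; _⇔_)
open import Function.Properties.Inverse using (Inverse⇒Injection)
open import Relation.Binary.Core using (Rel)
open import Relation.Binary.Definitions using (Decidable)
open import Relation.Binary.Construct.Closure.Equivalence using (EqClosure)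
open import Relation.Binary.PropositionalEquality as ≡ using (_≡_; _≢_)
open import Relation.Binary.Structures using (IsStrictTotalOrder)
open import Relation.Nullary using (¬_; Dec; yes; no)
open import Relation.Nullary.Decidable using (map′; via-injection)
open import Relation.Unary using (Pred; _∈_; _⊆_; U)
import Relation.Unary as Unary
import Algebra.Properties.CommutativeMonoid.Sum as Sum

least : ∀ {p} {P : Pred ℕ p} → Unary.Decidable P → ∀ b → P b →
        ∃ λ k → P k × (∀ {i} → P i → k ℕ.≤ i)
least P? zero p = 0 , p , λ _ → z≤n
least {P = P} P? (suc b) p with P? 0
... | yes p₀ = 0 , p₀ , λ _ → z≤n
... | no ¬p₀ with least {P = P ∘ suc} (P? ∘ suc) b p
...   | k , pk , k-min = suc k , pk , λ { {zero}  q → ⊥-elim (¬p₀ q)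
                                        ; {suc i} q → s≤s (k-min q) }

-- Every entry is finite: m i j is the order of sᵢsⱼ, and only finite
-- Coxeter groups are considered.
record IsCoxeterMatrix {n : ℕ} (m : Fin n → Fin n → ℕ) : Set where
  field
    diagonal    : ∀ i → m i i ≡ 1
    symmetric   : ∀ i j → m i j ≡ m j i
    offDiagonal : ∀ {i j} → i ≢ j → 2 ℕ.≤ m i j

-- Insertion of a relator (sᵢsⱼ)^m(i,j) anywhere in a word.  The relators
-- for i = j are sᵢsᵢ, so words in the sᵢ alone, without formal inverses,
-- suffice to present the Coxeter group.
data Insertion {n : ℕ} (m : Fin n → Fin n → ℕ) : Rel (List (Fin n)) 0ℓ where
  insert : ∀ p q i j →
    Insertion m (p ++ q) (p ++ concat (replicate (m i j) (i ∷ j ∷ [])) ++ q)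

-- The simple reflections are indexed by Fin n, which fixes an ordering of S:
-- s i is the generator written s_{i+1} when counting from 1.
record FiniteCoxeterSystem (n : ℕ) (c ℓ : Level) : Set (lsuc (c ⊔ ℓ)) where
  field
    group : Group c ℓ
  open Group group public

  field
    m               : Fin n → Fin n → ℕ
    isCoxeterMatrix : IsCoxeterMatrix m
    s               : Fin n → Carrier

  eval : List (Fin n) → Carrier
  eval = foldr (λ i w → s i ∙ w) ε

  field
    generated    : ∀ w → ∃[ v ] eval v ≈ w
    presentation : ∀ u v → eval u ≈ eval v ⇔ EqClosure (Insertion m) u v
    order        : ℕ
    finite       : Inverse setoid (≡.setoid (Fin order))

module CoxeterGroup {n : ℕ} {c ℓ : Level} (C : FiniteCoxeterSystem n c ℓ) where
  open FiniteCoxeterSystem C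

  _≈?_ : Decidable _≈_
  _≈?_ = via-injection (Inverse⇒Injection finite) _≟ᶠ_

  HasWord : Carrier → ℕ → Set ℓ
  HasWord w k = Σ[ v ∈ List (Fin n) ] length v ≡ k × eval v ≈ w

  hasWord? : ∀ w → Unary.Decidable (HasWord w)
  hasWord? w zero = map′ (λ e → [] , ≡.refl , e)
                         (λ { ([] , _ , e) → e ; (_ ∷ _ , () , _) })
                         (ε ≈? w)
  hasWord? w (suc k) = map′ to from (any? λ i → hasWord? (s i ⁻¹ ∙ w) k)
    where
    to : ∃ (λ i → HasWord (s i ⁻¹ ∙ w) k) → HasWord w (suc k)
    to (i , v , l , e) = i ∷ v , ≡.cong suc l ,
      trans (∙-congˡ e) (trans (sym (assoc (s i) (s i ⁻¹) w))
        (trans (∙-congʳ (inverseʳ (s i))) (identityˡ w)))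
    from : HasWord w (suc k) → ∃ (λ i → HasWord (s i ⁻¹ ∙ w) k)
    from (i ∷ v , l , e) = i , v , ≡.cong ℕ.pred l ,
      trans (sym (identityˡ (eval v))) (trans (∙-congʳ (sym (inverseˡ (s i))))
        (trans (assoc (s i ⁻¹) (s i) (eval v)) (∙-congˡ e)))

  shortest : ∀ w → ∃ λ k → HasWord w k × (∀ {i} → HasWord w i → k ℕ.≤ i)
  shortest w with generated w
  ... | v , e = least (hasWord? w) (length v) (v , ≡.refl , e)

  len : Carrier → ℕ
  len w = proj₁ (shortest w)

  reducedWord : Carrier → List (Fin n)
  reducedWord w = proj₁ (proj₁ (proj₂ (shortest w)))

  data ⟨_⟩ (I : Pred (Fin n) 0ℓ) : Pred Carrier (c ⊔ ℓ) where
    gen  : ∀ {i} → i ∈ I → s i ∈ ⟨ I ⟩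
    unit : ε ∈ ⟨ I ⟩
    mul  : ∀ {x y} → x ∈ ⟨ I ⟩ → y ∈ ⟨ I ⟩ → x ∙ y ∈ ⟨ I ⟩
    inv  : ∀ {x} → x ∈ ⟨ I ⟩ → x ⁻¹ ∈ ⟨ I ⟩
    resp : ∀ {x y} → x ≈ y → x ∈ ⟨ I ⟩ → y ∈ ⟨ I ⟩

  MinRep : (I J : Pred (Fin n) 0ℓ) → Pred Carrier (c ⊔ ℓ)
  MinRep I J w = w ∈ ⟨ J ⟩ × (∀ i → i ∈ I → len w ℕ.< len (s i ∙ w))

  IsProjection : Pred (Fin n) 0ℓ → Carrier → Carrier → Set (c ⊔ ℓ)
  IsProjection I w p = p ∈ ⟨ I ⟩ × ∃[ x ] x ∈ MinRep I U × w ≈ p ∙ x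

  Initial : Fin (suc n) → Pred (Fin n) 0ℓ
  Initial k i = toℕ i ℕ.< toℕ k

  -- For k : Fin n counted from 0, this is the set of representatives used in
  -- step k + 1 of the recursion, i.e. those of W_{I_k} \ W_{I_{k+1}}.
  Rep : Fin n → Set (c ⊔ ℓ)
  Rep k = ∃ (MinRep (Initial (inject₁ k)) (Initial (suc k)))

record OrderedField (c ℓ₁ ℓ₂ : Level) : Set (lsuc (c ⊔ ℓ₁ ⊔ ℓ₂)) where
  field
    commutativeRing : CommutativeRing c ℓ₁
  open CommutativeRing commutativeRing public

  field
    _<_                : Rel Carrier ℓ₂
    isStrictTotalOrder : IsStrictTotalOrder _≈_ _<_
    0<1                : 0# < 1#
    +-monoˡ-<          : ∀ {x y} z → x < y → (x + z) < (y + z)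
    *-pos              : ∀ {x y} → 0# < x → 0# < y → 0# < (x * y)
    inverse            : ∀ x → ¬ (x ≈ 0#) → ∃[ y ] x * y ≈ 1#

module Cosine {a ℓ₁ ℓ₂ : Level} (K : OrderedField a ℓ₁ ℓ₂) where
  open OrderedField K

  -- If x = cos θ then sinRatio x k = sin (k θ) / sin θ
  -- (the Chebyshev polynomial U_{k-1} at x).
  sinRatio : Carrier → ℕ → Carrier
  sinRatio x zero          = 0#
  sinRatio x (suc zero)    = 1#
  sinRatio x (suc (suc k)) = (x + x) * sinRatio x (suc k) - sinRatio x k

  -- For m ≥ 2: x = cos (π/m).  Over ℝ, U_{m-1}(x) = 0 means x = cos (jπ/m)
  -- for some 1 ≤ j < m, and U_{k-1}(x) > 0 for all 1 ≤ k < m forces j = 1.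
  IsCosπ/ : ℕ → Carrier → Set (ℓ₁ ⊔ ℓ₂)
  IsCosπ/ m x = sinRatio x m ≈ 0# ×
                (∀ k → 1 ℕ.≤ k → k ℕ.< m → 0# < sinRatio x k)

-- The root system of the geometric representation, over an ordered field K
-- in which cosπ/ m plays the role of cos (π/m).
module RootSystem {n : ℕ} {c ℓ a ℓ₁ ℓ₂ : Level}
                  (C : FiniteCoxeterSystem n c ℓ)
                  (K : OrderedField a ℓ₁ ℓ₂)
                  (cosπ/ : ℕ → OrderedField.Carrier K) where
  open FiniteCoxeterSystem C using (m) renaming (Carrier to W)
  open CoxeterGroup C using (reducedWord)
  open OrderedField K
  open Sum +-commutativeMonoid using (sum)

  V : Set a
  V = Vector Carrier n

  _≋_ : Rel V ℓ₁
  u ≋ v = ∀ i → u i ≈ v i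

  δ : Fin n → Fin n → Carrier
  δ i j with i ≟ᶠ j
  ... | yes _ = 1#
  ... | no  _ = 0#

  α : Fin n → V
  α = δ

  -- B (αᵢ , αⱼ) = - cos (π / m(i,j)), which is 1 for i = j.
  gram : Fin n → Fin n → Carrier
  gram i j with i ≟ᶠ j
  ... | yes _ = 1#
  ... | no  _ = - cosπ/ (m i j)

  B : V → V → Carrier
  B u v = sum λ i → sum λ j → u i * gram i j * v j

  reflection : Fin n → V → V
  reflection i v j = v j - (B (α i) v + B (α i) v) * α i j

  -- The action of w does not depend on the word used to compute it.
  act : W → V → V
  act w v = foldr reflection v (reducedWord w)

  Φ : Pred V (c ⊔ ℓ₁)
  Φ β = ∃[ w ] ∃[ i ] β ≋ act w (α i)

  Φ⁺ : Pred V (c ⊔ ℓ₁ ⊔ ℓ₂)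
  Φ⁺ β = β ∈ Φ × (∀ i → ¬ (β i < 0#))

  Φ⁻ : Pred V (c ⊔ ℓ₁ ⊔ ℓ₂)
  Φ⁻ β = (λ i → - β i) ∈ Φ⁺

  Φ[_] : W → Pred V (c ⊔ a ⊔ ℓ₁ ⊔ ℓ₂)
  Φ[ w ] β = β ∈ Φ⁺ × (∃[ γ ] γ ∈ Φ⁻ × β ≋ act w γ)

  _≤_ : Rel W (c ⊔ a ⊔ ℓ₁ ⊔ ℓ₂)
  u ≤ w = Φ[ u ] ⊆ Φ[ w ]

IsMinimal : ∀ {a r p} {A : Set a} → Rel A r → Pred A p → A → Set (a ⊔ r ⊔ p)
IsMinimal _≺_ P x = P x × (∀ y → P y → ¬ (y ≺ x))

module Recursion {n : ℕ} {c ℓ a ℓ₁ ℓ₂ : Level}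
                 (C : FiniteCoxeterSystem n c ℓ)
                 (K : OrderedField a ℓ₁ ℓ₂)
                 (cosπ/ : ℕ → OrderedField.Carrier K) where
  open FiniteCoxeterSystem C
  open CoxeterGroup C
  open RootSystem C K cosπ/ using (_≤_)

  record IsLinearExtension {r : Level} (k : Fin n) (_≺_ : Rel (Rep k) r)
         : Set (c ⊔ ℓ ⊔ a ⊔ ℓ₁ ⊔ ℓ₂ ⊔ r) where
    field
      isStrictTotalOrder : IsStrictTotalOrder (_≈_ on proj₁) _≺_
      extends            : ∀ x y → proj₁ x ≤ proj₁ y → ¬ (proj₁ x ≈ proj₁ y) → x ≺ y

  record IsRun {r : Level} (≺ : (k : Fin n) → Rel (Rep k) r)
               (uₖ wₖ : Fin (suc n) → Carrier)
               (j : Fin (suc n) → Carrier) (z : (k : Fin n) → Rep k)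
         : Set (c ⊔ ℓ ⊔ a ⊔ ℓ₁ ⊔ ℓ₂ ⊔ r) where
    field
      start   : j zero ≈ ε
      step    : ∀ k → j (suc k) ≈ j (inject₁ k) ∙ proj₁ (z k)
      minimal : ∀ k → IsMinimal (≺ k)
                  (λ x → uₖ (suc k) ≤ (j (inject₁ k) ∙ proj₁ x) ×
                         wₖ (suc k) ≤ (j (inject₁ k) ∙ proj₁ x))
                  (z k)

module Submission where

-- Let v = u ∨ w.  Its projections v_k to W_{I_k} satisfy v_k = v_{k-1} z for a
-- minimal coset representative z.  Projection to W_I preserves joins: if w₀ = p d
-- with p ∈ W_I and d ∈ ᴵW, then x d is an upper bound of u and w for every upper
-- bound x ∈ W_I of u_I and w_I, and its projection is x.  Hence z ≤ z′ in weak order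
-- for every z′ admissible in step k, and z is the ≺-minimum.
--
-- Weak order is controlled by two facts about roots.  The root w⁻¹α_i is positive if
-- s_i w is longer than w and negative if it is shorter; and a positive root made
-- negative by an element of W_I lies in the span of the α_i with i ∈ I.  Joins
-- exist because they exist for two covers of a common element.
open import Defs
open import Level using (Level; _⊔_; 0ℓ)
open import Algebra.Bundles using (RawRing)
open import Algebra.Core using (Op₂)
import Algebra.Solver.Ring as RingSolver
open import Algebra.Solver.Ring.AlmostCommutativeRing using (fromCommutativeRing; _-Raw-AlmostCommutative⟶_)
open import Data.Empty using (⊥; ⊥-elim)
open import Data.Fin.Base using (Fin; zero; suc; toℕ; fromℕ; inject₁; punchIn)
open import Data.Fin.Induction using (<-weakInduction)
open import Data.Fin.Properties using (any?; punchInᵢ≢i; toℕ<n; toℕ-fromℕ; toℕ-inject₁) renaming (_≟_ to _≟ᶠ_)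
open import Data.List.Base using (List; []; _∷_; _++_; concat; foldr; length; replicate; map; allFin)
open import Data.List.Membership.Propositional.Properties using (∈-map⁺; ∈-allFin)
open import Data.List.Properties using (foldr-++; ++-identityʳ; length-++)
import Data.List.Relation.Unary.All as All
open import Data.Maybe.Base using (just; nothing)
open import Data.Nat.Base as ℕ using (ℕ; zero; suc; z≤n; s≤s; parity)
import Data.Nat.Properties as ℕₚ
open import Data.List.Extrema ℕₚ.≤-totalOrder using (argmax; f[xs]≤f[argmax])
import Data.Parity.Base as ℙ
import Data.Parity.Properties as ℙₚ
open import Data.Product.Base using (Σ; ∃; ∃-syntax; ∃₂; _×_; _,_; proj₁; proj₂)
open import Data.Sum.Base using (_⊎_; inj₁; inj₂; [_,_]′)
open import Data.Unit.Base using (tt)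
open import Function.Base using (_∘_)
open import Function.Bundles using (Equivalence; Inverse)
import Relation.Binary.Construct.Closure.Equivalence as EqClosure
open import Relation.Binary.Core using (Rel)
open import Relation.Binary.Definitions using (WeaklyDecidable; tri<; tri≈; tri>)
open import Relation.Binary.Lattice.Definitions using (Supremum)
open import Relation.Binary.PropositionalEquality as ≡ using (_≡_; _≢_)
open import Relation.Binary.Structures using (IsStrictTotalOrder)
open import Relation.Nullary using (¬_; Dec; yes; no)
open import Relation.Nullary.Decidable using (_×-dec_; _⊎-dec_)
open import Relation.Unary using (Pred; _∈_; _⊆_)
import Relation.Unary as Unary

-- `K` is an arbitrary ordered field, so angles are out of reach: `cosπ/ m` is known only through
-- the vanishing of `sinRatio` at m and its positivity below m. From these two conditions come the
-- trivial action of (s_i s_j)^m(i,j), without which words of equal value need not act alike, and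
-- the nonnegative dihedral coefficients in the proof that ascents give positive roots. That result
-- makes the sign of every root decidable by comparing lengths, and from then on weak order is a
-- calculus of signs. If v = p x with p ∈ W_I and x ∈ ᴵW, then the map x⁻¹ keeps signs on roots in
-- the span of the α_i with i ∈ I, so the inversions of p are exactly the inversions of v in that
-- span. Monotonicity of projections and the upper bound x d both rest on this.

-- Ordered fields: ring solver and signs.

module FieldProperties {a ℓ₁ ℓ₂ : Level} (K : OrderedField a ℓ₁ ℓ₂) where
  open OrderedField K renaming (_<_ to infix 4 _<_)
  open IsStrictTotalOrder isStrictTotalOrder public
    using (compare) renaming (irrefl to <-irrefl; trans to <-trans; <-respʳ-≈ to <-respʳ; <-respˡ-≈ to <-respˡ)
  open Cosine K
  open import Algebra.Properties.Ring ring public using (-‿distribˡ-*; -‿distribʳ-*; -‿involutive; -0#≈0#)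
  open import Algebra.Properties.AbelianGroup +-abelianGroup public using () renaming (⁻¹-∙-comm to -‿+-comm)
  open import Algebra.Properties.CommutativeSemigroup +-commutativeSemigroup using (interchange)
  open import Algebra.Properties.Semiring.Mult semiring using (×1-homo-*; ×-homo-+) renaming (_×_ to _×ᴷ_)
  open import Relation.Binary.Reasoning.Setoid setoid

  -- Integer coefficients for the ring solver: (p , q) stands for p - q.
  private
    ℕ² : RawRing _ _
    ℕ² = record
      { Carrier = ℕ × ℕ
      ; _≈_ = _≡_
      ; _+_ = λ (p , q) (p′ , q′) → p ℕ.+ p′ , q ℕ.+ q′
      ; _*_ = λ (p , q) (p′ , q′) → p ℕ.* p′ ℕ.+ q ℕ.* q′ , p ℕ.* q′ ℕ.+ q ℕ.* p′
      ; -_ = λ (p , q) → q , p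
      ; 0# = 0 , 0
      ; 1# = 1 , 0
      }

    difference : ℕ × ℕ → Carrier
    difference (p , q) = p ×ᴷ 1# - q ×ᴷ 1#

    difference-+ : ∀ x y z w → (x + z) - (y + w) ≈ (x - y) + (z - w)
    difference-+ x y z w = trans (+-congˡ (sym (-‿+-comm y w))) (interchange x z (- y) (- w))

    difference-* : ∀ x y z w → (x * z + y * w) - (x * w + y * z) ≈ (x - y) * (z - w)
    difference-* x y z w = begin
      (x * z + y * w) - (x * w + y * z)          ≈⟨ difference-+ _ _ _ _ ⟩
      (x * z - x * w) + (y * w - y * z)          ≈⟨ +-cong (+-congˡ (-‿distribʳ-* x w)) (+-comm _ _) ⟩
      (x * z + x * - w) + (- (y * z) + y * w)    ≈⟨ +-cong (sym (distribˡ x z (- w))) (+-cong (-‿distribˡ-* y z) y*w≈-y*-w) ⟩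
      x * (z - w) + (- y * z + - y * - w)        ≈⟨ +-congˡ (sym (distribˡ (- y) z (- w))) ⟩
      x * (z - w) + - y * (z - w)                ≈⟨ distribʳ (z - w) x (- y) ⟨
      (x - y) * (z - w)                          ∎
      where
      y*w≈-y*-w : y * w ≈ - y * - w
      y*w≈-y*-w = trans (sym (-‿involutive (y * w))) (trans (-‿cong (-‿distribʳ-* y w)) (-‿distribˡ-* y (- w)))

    -- Chosen so that closed coefficients with equal value compute to the same
    -- expression, and 0 and 1 to 0# and 1#: the solver compares normal forms by refl.
    value : ℕ × ℕ → Carrier
    value (suc p , suc q) = value (p , q)
    value (0     , 0)     = 0#
    value (1     , 0)     = 1#
    value (p     , q)     = difference (p , q)

    value≈difference : ∀ p q → value (p , q) ≈ difference (p , q)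
    value≈difference (suc p)       (suc q) = begin
      value (p , q)                          ≈⟨ value≈difference p q ⟩
      difference (p , q)                     ≈⟨ +-identityˡ _ ⟨
      0# + difference (p , q)                ≈⟨ +-congʳ (-‿inverseʳ 1#) ⟨
      (1# - 1#) + difference (p , q)         ≈⟨ difference-+ 1# 1# _ _ ⟨
      difference (suc p , suc q)             ∎
    value≈difference 0             0       = sym (-‿inverseʳ 0#)
    value≈difference 0             (suc q) = refl
    value≈difference 1             0       = sym (trans (+-cong (+-identityʳ 1#) -0#≈0#) (+-identityʳ 1#))
    value≈difference (suc (suc p)) 0       = refl

    morphism : ℕ² -Raw-AlmostCommutative⟶ fromCommutativeRing commutativeRing
    morphism = record
      { ⟦_⟧    = value
      ; +-homo = λ x@(p , q) y@(p′ , q′) → begin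
          value (p ℕ.+ p′ , q ℕ.+ q′)       ≈⟨ value≈difference (p ℕ.+ p′) (q ℕ.+ q′) ⟩
          difference (p ℕ.+ p′ , q ℕ.+ q′)  ≈⟨ +-cong (×-homo-+ 1# p p′) (-‿cong (×-homo-+ 1# q q′)) ⟩
          _                                 ≈⟨ difference-+ _ _ _ _ ⟩
          difference x + difference y       ≈⟨ +-cong (value≈difference p q) (value≈difference p′ q′) ⟨
          value x + value y                 ∎
      ; *-homo = λ x@(p , q) y@(p′ , q′) → begin
          value (p ℕ.* p′ ℕ.+ q ℕ.* q′ , p ℕ.* q′ ℕ.+ q ℕ.* p′)
            ≈⟨ value≈difference (p ℕ.* p′ ℕ.+ q ℕ.* q′) (p ℕ.* q′ ℕ.+ q ℕ.* p′) ⟩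
          difference (p ℕ.* p′ ℕ.+ q ℕ.* q′ , p ℕ.* q′ ℕ.+ q ℕ.* p′)
            ≈⟨ +-cong (×1-homo-+* p p′ q q′) (-‿cong (×1-homo-+* p q′ q p′)) ⟩
          _                            ≈⟨ difference-* _ _ _ _ ⟩
          difference x * difference y  ≈⟨ *-cong (value≈difference p q) (value≈difference p′ q′) ⟨
          value x * value y            ∎
      ; -‿homo = λ x@(p , q) → begin
          value (q , p)             ≈⟨ value≈difference q p ⟩
          q ×ᴷ 1# - p ×ᴷ 1#         ≈⟨ +-comm _ _ ⟩
          - (p ×ᴷ 1#) + q ×ᴷ 1#     ≈⟨ +-congˡ (-‿involutive _) ⟨
          - (p ×ᴷ 1#) - - (q ×ᴷ 1#) ≈⟨ -‿+-comm _ _ ⟩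
          - difference x            ≈⟨ -‿cong (value≈difference p q) ⟨
          - value x                 ∎
      ; 0-homo = refl
      ; 1-homo = refl
      }
      where
      ×1-homo-+* : ∀ p p′ q q′ → (p ℕ.* p′ ℕ.+ q ℕ.* q′) ×ᴷ 1# ≈ p ×ᴷ 1# * p′ ×ᴷ 1# + q ×ᴷ 1# * q′ ×ᴷ 1#
      ×1-homo-+* p p′ q q′ = trans (×-homo-+ 1# (p ℕ.* p′) (q ℕ.* q′)) (+-cong (×1-homo-* p p′) (×1-homo-* q q′))

    _coeff≟_ : WeaklyDecidable (λ x y → value x ≈ value y)
    (p , q) coeff≟ (p′ , q′) with p ℕ.+ q′ ℕₚ.≟ p′ ℕ.+ q
    ... | no  _  = nothing
    ... | yes eq = just (begin
      value (p , q)          ≈⟨ value≈difference p q ⟩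
      x - y                  ≈⟨ +-identityʳ (x - y) ⟨
      (x - y) + 0#           ≈⟨ +-congˡ (-‿inverseʳ w) ⟨
      (x - y) + (w - w)      ≈⟨ difference-+ x y w w ⟨
      (x + w) - (y + w)      ≈⟨ +-cong x+w≈z+y (-‿cong (+-comm y w)) ⟩
      (z + y) - (w + y)      ≈⟨ difference-+ z w y y ⟩
      (z - w) + (y - y)      ≈⟨ +-congˡ (-‿inverseʳ y) ⟩
      (z - w) + 0#           ≈⟨ +-identityʳ (z - w) ⟩
      z - w                  ≈⟨ value≈difference p′ q′ ⟨
      value (p′ , q′)        ∎)
      where
      x = p ×ᴷ 1# ; y = q ×ᴷ 1# ; z = p′ ×ᴷ 1# ; w = q′ ×ᴷ 1#
      x+w≈z+y : x + w ≈ z + y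
      x+w≈z+y = trans (sym (×-homo-+ 1# p q′)) (trans (reflexive (≡.cong (_×ᴷ 1#) eq)) (×-homo-+ 1# p′ q))

  open RingSolver ℕ² (fromCommutativeRing commutativeRing) morphism _coeff≟_ public
    using (solve; _:=_; _:+_; _:*_; _:-_; :-_; con; Polynomial)

  :1 : ∀ {k} → Polynomial k
  :1 = con (1 , 0)

  :0 : ∀ {k} → Polynomial k
  :0 = con (0 , 0)

  NonNeg : Carrier → Set ℓ₂
  NonNeg x = ¬ (x < 0#)

  NonNeg-resp : ∀ {x y} → x ≈ y → NonNeg x → NonNeg y
  NonNeg-resp x≈y x≮0 y<0 = x≮0 (<-respˡ (sym x≈y) y<0)

  NonNeg-0 : ∀ {x} → x ≈ 0# → NonNeg x
  NonNeg-0 x≈0 x<0 = <-irrefl x≈0 x<0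

  pos⇒NonNeg : ∀ {x} → 0# < x → NonNeg x
  pos⇒NonNeg 0<x x<0 = <-irrefl refl (<-trans 0<x x<0)

  NonNeg-cases : ∀ {x} → NonNeg x → 0# < x ⊎ x ≈ 0#
  NonNeg-cases {x} x≮0 with compare x 0#
  ... | tri< x<0 _ _ = ⊥-elim (x≮0 x<0)
  ... | tri≈ _ x≈0 _ = inj₂ x≈0
  ... | tri> _ _ 0<x = inj₁ 0<x

  pos-+ : ∀ {x y} → 0# < x → NonNeg y → 0# < x + y
  pos-+ {x} {y} 0<x y≮0 with NonNeg-cases y≮0
  ... | inj₁ 0<y = <-trans 0<y (<-respˡ (+-identityˡ y) (+-monoˡ-< y 0<x))
  ... | inj₂ y≈0 = <-respʳ (trans (sym (+-identityʳ x)) (+-congˡ (sym y≈0))) 0<x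

  pos-half : ∀ {x} → 0# < x + x → 0# < x
  pos-half {x} 0<x+x with compare 0# x
  ... | tri< 0<x _ _ = 0<x
  ... | tri≈ _ 0≈x _ = ⊥-elim (<-irrefl (sym (trans (+-cong (sym 0≈x) (sym 0≈x)) (+-identityʳ 0#))) 0<x+x)
  ... | tri> _ _ x<0 = ⊥-elim (<-irrefl refl (<-trans 0<x+x (<-trans (<-respʳ (+-identityˡ x) (+-monoˡ-< x x<0)) x<0)))

  NonNeg-+ : ∀ {x y} → NonNeg x → NonNeg y → NonNeg (x + y)
  NonNeg-+ {x} {y} x≮0 y≮0 with NonNeg-cases x≮0
  ... | inj₁ 0<x = pos⇒NonNeg (pos-+ 0<x y≮0)
  ... | inj₂ x≈0 = NonNeg-resp (trans (sym (+-identityˡ y)) (+-congʳ (sym x≈0))) y≮0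

  NonNeg-* : ∀ {x y} → NonNeg x → NonNeg y → NonNeg (x * y)
  NonNeg-* {x} {y} x≮0 y≮0 with NonNeg-cases x≮0 | NonNeg-cases y≮0
  ... | inj₁ 0<x | inj₁ 0<y = pos⇒NonNeg (*-pos 0<x 0<y)
  ... | inj₂ x≈0 | _        = NonNeg-0 (trans (*-congʳ x≈0) (zeroˡ y))
  ... | inj₁ _   | inj₂ y≈0 = NonNeg-0 (trans (*-congˡ y≈0) (zeroʳ x))

  NonNeg-antisym : ∀ {x} → NonNeg x → NonNeg (- x) → x ≈ 0#
  NonNeg-antisym {x} x≮0 -x≮0 with NonNeg-cases x≮0
  ... | inj₂ x≈0 = x≈0
  ... | inj₁ 0<x = ⊥-elim (-x≮0 (<-respʳ (-‿inverseʳ x) (<-respˡ (+-identityˡ (- x)) (+-monoˡ-< (- x) 0<x))))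

  pos-cancel : ∀ {x p} → 0# < x → x * p ≈ 0# → p ≈ 0#
  pos-cancel {x} {p} 0<x xp≈0 with inverse x (λ x≈0 → <-irrefl (sym x≈0) 0<x)
  ... | y , xy≈1 = begin
    p            ≈⟨ solve 3 (λ x y p → p := (:1 :- x :* y) :* p :+ y :* (x :* p)) refl x y p ⟩
    (1# - x * y) * p + y * (x * p)  ≈⟨ +-cong (*-congʳ (+-congˡ (-‿cong xy≈1))) (*-congˡ xp≈0) ⟩
    (1# - 1#) * p + y * 0#          ≈⟨ solve 2 (λ y p → (:1 :- :1) :* p :+ y :* :0 := :0) refl y p ⟩
    0#           ∎

  -- Chebyshev values: half turns, full turns and positivity.

  module SinRatio (c : Carrier) where
    U : ℕ → Carrier
    U = sinRatio c

    -- The law of cosines for sin((k+1)θ), sin(kθ) and sin θ, divided by sin²θ. One step of the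
    -- recursion leaves the quadratic form on the left unchanged.
    sinRatio-norm : ∀ k → U (suc k) * U (suc k) + U k * U k - (c + c) * (U (suc k) * U k) ≈ 1#
    sinRatio-norm zero    = solve 1 (λ c → :1 :* :1 :+ :0 :* :0 :- (c :+ c) :* (:1 :* :0) := :1) refl c
    sinRatio-norm (suc k) = trans
      (solve 3 (λ c x y →
          ((c :+ c) :* x :- y) :* ((c :+ c) :* x :- y) :+ x :* x :- (c :+ c) :* (((c :+ c) :* x :- y) :* x)
          := x :* x :+ y :* y :- (c :+ c) :* (x :* y)) refl c (U (suc k)) (U k))
      (sinRatio-norm k)

    -- If p is nonzero then c = 1, and sinRatio 1 k = k.
    sinRatio-degenerate : ∀ {p} → p ≈ c * p → ∀ k → U (suc k) * p - U k * p ≈ p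
    sinRatio-degenerate {p} p≈cp zero = solve 1 (λ p → :1 :* p :- :0 :* p := p) refl p
    sinRatio-degenerate {p} p≈cp (suc k) = begin
      ((c + c) * U (suc k) - U k) * p - U (suc k) * p
        ≈⟨ solve 4 (λ c p x y → ((c :+ c) :* x :- y) :* p :- x :* p
             := (x :+ x) :* (c :* p) :- y :* p :- x :* p) refl c p (U (suc k)) (U k) ⟩
      (U (suc k) + U (suc k)) * (c * p) - U k * p - U (suc k) * p
        ≈⟨ +-congʳ (+-congʳ (*-congˡ (sym p≈cp))) ⟩
      (U (suc k) + U (suc k)) * p - U k * p - U (suc k) * p
        ≈⟨ solve 3 (λ p x y → (x :+ x) :* p :- y :* p :- x :* p := x :* p :- y :* p) refl p (U (suc k)) (U k) ⟩
      U (suc k) * p - U k * p  ≈⟨ sinRatio-degenerate p≈cp k ⟩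
      p ∎

    -- A second-order linear recursion is determined by two consecutive values, and those at m and m
    -- + 1 are the negatives of those at 0 and 1.
    sinRatio-antiperiodic : ∀ {m} → U m ≈ 0# → U (suc m) ≈ - 1# → ∀ k →
      U (k ℕ.+ m) ≈ - U k × U (suc (k ℕ.+ m)) ≈ - U (suc k)
    sinRatio-antiperiodic eq₀ eq₁ zero    = trans eq₀ (sym -0#≈0#) , eq₁
    sinRatio-antiperiodic eq₀ eq₁ (suc k) with sinRatio-antiperiodic eq₀ eq₁ k
    ... | eqₖ , eqₖ₊₁ = eqₖ₊₁ , trans (+-cong (*-congˡ eqₖ₊₁) (-‿cong eqₖ))
      (solve 3 (λ c x y → (c :+ c) :* (:- x) :- (:- y) := :- ((c :+ c) :* x :- y)) refl c (U (suc k)) (U k))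

    -- The hypothesis on m is an equation, not a pattern, so that sinRatio does
    -- not unfold at m.
    module _ {m m′ : ℕ} (m≡2+m′ : m ≡ suc (suc m′)) (isCos : IsCosπ/ m c) where
      private
        x : Carrier
        x = U (suc m′)

        0<x : 0# < x
        0<x = proj₂ isCos (suc m′) (s≤s z≤n) (ℕₚ.≤-reflexive (≡.sym m≡2+m′))

        U-m≈0 : U m ≈ 0#
        U-m≈0 = proj₁ isCos

        U-2+m′≈0 : U (suc (suc m′)) ≈ 0#
        U-2+m′≈0 = trans (reflexive (≡.cong U (≡.sym m≡2+m′))) U-m≈0

        0<1+x : 0# < 1# + x
        0<1+x = pos-+ 0<1 (pos⇒NonNeg 0<x)

      sinRatio-NonNeg : ∀ {k} → k ℕ.≤ m → NonNeg (U k)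
      sinRatio-NonNeg {zero} _ = NonNeg-0 refl
      sinRatio-NonNeg {suc k} k<m with ℕₚ.m≤n⇒m<n∨m≡n k<m
      ... | inj₁ k+1<m  = pos⇒NonNeg (proj₂ isCos (suc k) (s≤s z≤n) k+1<m)
      ... | inj₂ ≡.refl = NonNeg-0 (proj₁ isCos)

      private
        -- sin((m-1)π/m) = sin(π/m): since `U m` vanishes, `sinRatio-norm` leaves x² = 1, and x > 0
        -- rules out the root -1.
        x≈1 : x ≈ 1#
        x≈1 = begin
          x              ≈⟨ solve 1 (λ x → x := (x :- :1) :+ :1) refl x ⟩
          (x - 1#) + 1#  ≈⟨ +-congʳ (pos-cancel 0<1+x (begin
            (1# + x) * (x - 1#)
              ≈⟨ solve 1 (λ x → (:1 :+ x) :* (x :- :1) := x :* x :- :1) refl x ⟩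
            x * x - 1#
              ≈⟨ +-congˡ (-‿cong (sinRatio-norm (suc m′))) ⟨
            x * x - (U (suc (suc m′)) * U (suc (suc m′)) + x * x - (c + c) * (U (suc (suc m′)) * x))
              ≈⟨ +-congˡ (-‿cong (+-cong (+-congʳ (*-congʳ U-2+m′≈0)) (-‿cong (*-congˡ (*-congʳ U-2+m′≈0))))) ⟩
            x * x - (0# * U (suc (suc m′)) + x * x - (c + c) * (0# * x))
              ≈⟨ solve 3 (λ c x y → x :* x :- (:0 :* y :+ x :* x :- (c :+ c) :* (:0 :* x)) := :0) refl c x (U (suc (suc m′))) ⟩
            0# ∎)) ⟩
          0# + 1#        ≈⟨ +-identityˡ 1# ⟩
          1#             ∎

      sinRatio-half-turn : U (suc m) ≈ - 1#
      sinRatio-half-turn = begin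
        U (suc m)                        ≡⟨ ≡.cong (λ k → U (suc k)) m≡2+m′ ⟩
        (c + c) * U (suc (suc m′)) - x   ≈⟨ +-cong (*-congˡ U-2+m′≈0) (-‿cong x≈1) ⟩
        (c + c) * 0# - 1#                ≈⟨ solve 1 (λ c → (c :+ c) :* :0 :- :1 := :- :1) refl c ⟩
        - 1#                             ∎

      private
        -- 2c is `U 2`, which is positive for m > 2 and zero for m = 2.
        NonNeg-2c : NonNeg (c + c)
        NonNeg-2c = NonNeg-resp (solve 1 (λ c → (c :+ c) :* :1 :- :0 := c :+ c) refl c)
                                (sinRatio-NonNeg {2} (≡.subst (2 ℕ.≤_) (≡.sym m≡2+m′) (s≤s (s≤s z≤n))))

        0<1+c : 0# < 1# + c
        0<1+c = pos-half (<-respʳ (solve 1 (λ c → :1 :+ (:1 :+ (c :+ c)) := (:1 :+ c) :+ (:1 :+ c)) refl c)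
                                  (pos-+ 0<1 (pos⇒NonNeg (pos-+ 0<1 NonNeg-2c))))

      -- The Gram matrix of two simple roots is nonsingular.
      radical-trivial : ∀ {p q} → p ≈ c * q → q ≈ c * p → p ≈ 0#
      radical-trivial {p} {q} p≈cq q≈cp = pos-cancel 0<1+x (begin
        (1# + x) * p
          ≈⟨ solve 3 (λ x y p → (:1 :+ x) :* p := p :- (y :* p :- x :* p) :+ y :* p) refl x (U (suc (suc m′))) p ⟩
        p - (U (suc (suc m′)) * p - x * p) + U (suc (suc m′)) * p
          -- Once p = q, the hypothesis reads p = c p, so multiplying the last two values of `U` by
          -- p gives elements differing by p; the later value is 0, whence - x p = p.
          ≈⟨ +-cong (+-congˡ (-‿cong (sinRatio-degenerate (trans p≈cq (*-congˡ (sym p≈q))) (suc m′)))) (*-congʳ U-2+m′≈0) ⟩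
        p - p + 0# * p
          ≈⟨ solve 1 (λ p → p :- p :+ :0 :* p := :0) refl p ⟩
        0# ∎)
        where
        p≈q : p ≈ q
        p≈q = begin
          p             ≈⟨ solve 2 (λ p q → p := (p :- q) :+ q) refl p q ⟩
          (p - q) + q   ≈⟨ +-congʳ (pos-cancel 0<1+c (begin
            (1# + c) * (p - q)             ≈⟨ solve 3 (λ c p q → (:1 :+ c) :* (p :- q) := (p :- q) :+ (c :* p :- c :* q)) refl c p q ⟩
            (p - q) + (c * p - c * q)      ≈⟨ +-congˡ (+-cong (sym q≈cp) (-‿cong (sym p≈cq))) ⟩
            (p - q) + (q - p)              ≈⟨ solve 2 (λ p q → (p :- q) :+ (q :- p) := :0) refl p q ⟩
            0#                             ∎)) ⟩
          0# + q        ≈⟨ +-identityˡ q ⟩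
          q             ∎

      -- Two half turns, by antiperiodicity at m itself. The index 2m is the one required later
      -- because each factor s_i s_j rotates by 2θ.
      sinRatio-full-turn : U (m ℕ.* 2) ≈ 0# × U (suc (m ℕ.* 2)) ≈ 1#
      sinRatio-full-turn with m ℕ.* 2 | ≡.trans (ℕₚ.*-comm m 2) (≡.cong (m ℕ.+_) (ℕₚ.+-identityʳ m)) | sinRatio-antiperiodic U-m≈0 sinRatio-half-turn m
      ... | _ | ≡.refl | eq₀ , eq₁ = trans eq₀ (trans (-‿cong U-m≈0) -0#≈0#) ,
                                     trans eq₁ (trans (-‿cong sinRatio-half-turn) (-‿involutive 1#))

-- Length, parity and alternating words.

module Length {n : ℕ} {c ℓ : Level} (C : FiniteCoxeterSystem n c ℓ) where
  open FiniteCoxeterSystem C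
  open IsCoxeterMatrix isCoxeterMatrix
  open CoxeterGroup C
  open import Algebra.Properties.Group group public
    using (inverseʳ-unique; ε⁻¹≈ε; ⁻¹-anti-homo-∙; ⁻¹-involutive)
  open import Relation.Binary.Reasoning.Setoid setoid

  relator : Fin n → Fin n → ℕ → List (Fin n)
  relator i j k = concat (replicate k (i ∷ j ∷ []))

  eval-relator : ∀ i j → eval (relator i j (m i j)) ≈ ε
  eval-relator i j = sym (Equivalence.from (presentation [] _) (EqClosure.return
    (≡.subst (Insertion m []) (++-identityʳ (relator i j (m i j))) (insert [] [] i j))))

  s-involutive : ∀ i → s i ∙ s i ≈ ε
  s-involutive i = begin
    s i ∙ s i                     ≈⟨ ∙-congˡ (identityʳ (s i)) ⟨
    eval (relator i i 1)          ≡⟨ ≡.cong (eval ∘ relator i i) (diagonal i) ⟨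
    eval (relator i i (m i i))    ≈⟨ eval-relator i i ⟩
    ε                             ∎

  s⁻¹≈s : ∀ i → s i ⁻¹ ≈ s i
  s⁻¹≈s i = sym (inverseʳ-unique (s i) (s i) (s-involutive i))

  s-cancel : ∀ i w → s i ∙ (s i ∙ w) ≈ w
  s-cancel i w = trans (sym (assoc _ _ _)) (trans (∙-congʳ (s-involutive i)) (identityˡ w))

  cancelˡ : ∀ x y → x ⁻¹ ∙ (x ∙ y) ≈ y
  cancelˡ x y = trans (sym (assoc _ _ _)) (trans (∙-congʳ (inverseˡ x)) (identityˡ y))

  cancelʳ : ∀ x y → x ∙ (x ⁻¹ ∙ y) ≈ y
  cancelʳ x y = trans (sym (assoc _ _ _)) (trans (∙-congʳ (inverseʳ x)) (identityˡ y))

  len-≤ : ∀ {w k} → HasWord w k → len w ℕ.≤ k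
  len-≤ {w} = proj₂ (proj₂ (shortest w))

  hasWord-len : ∀ w → HasWord w (len w)
  hasWord-len w = proj₁ (proj₂ (shortest w))

  len-cong : ∀ {w w′} → w ≈ w′ → len w ≡ len w′
  len-cong w≈w′ = ℕₚ.≤-antisym (len-mono (sym w≈w′)) (len-mono w≈w′)
    where
    len-mono : ∀ {w w′} → w ≈ w′ → len w′ ℕ.≤ len w
    len-mono {w} w≈w′ with hasWord-len w
    ... | v , l , e = len-≤ (v , l , trans e w≈w′)

  len-eval-∙ : ∀ u w → len (eval u ∙ w) ℕ.≤ length u ℕ.+ len w
  len-eval-∙ []      w = ℕₚ.≤-reflexive (len-cong (identityˡ w))
  len-eval-∙ (i ∷ u) w = ℕₚ.≤-trans (ℕₚ.≤-reflexive (len-cong (assoc _ _ _)))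
    (ℕₚ.≤-trans (len-s (eval u ∙ w)) (s≤s (len-eval-∙ u w)))
    where
    len-s : ∀ w → len (s i ∙ w) ℕ.≤ suc (len w)
    len-s w with hasWord-len w
    ... | v , l , e = len-≤ (i ∷ v , ≡.cong suc l , ∙-congˡ e)

  len-s-∙ : ∀ i w → len (s i ∙ w) ℕ.≤ suc (len w)
  len-s-∙ i w = ℕₚ.≤-trans (ℕₚ.≤-reflexive (len-cong (∙-congʳ (sym (identityʳ (s i)))))) (len-eval-∙ (i ∷ []) w)

  -- The sign character: every relator has even length 2 m(i,j), so insertions preserve parity.
  -- Hence left multiplication by a generator never fixes the length.
  parity-eval : ∀ u v → eval u ≈ eval v → parity (length u) ≡ parity (length v)
  parity-eval u v eq = EqClosure.gfold ≡.isEquivalence (parity ∘ length) parity-insertion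
    (Equivalence.to (presentation u v) eq)
    where
    parity-relator : ∀ i j k q → parity (length q) ≡ parity (length (relator i j k ++ q))
    parity-relator i j zero    q = ≡.refl
    parity-relator i j (suc k) q = parity-relator i j k q

    parity-prefix : ∀ p {q q′ : List (Fin n)} → parity (length q) ≡ parity (length q′) →
      parity (length (p ++ q)) ≡ parity (length (p ++ q′))
    parity-prefix p {q} {q′} eq rewrite length-++ p {q} | length-++ p {q′}
      | ℙₚ.+-homo-+ (length p) (length q) | ℙₚ.+-homo-+ (length p) (length q′) = ≡.cong (parity (length p) ℙ.+_) eq

    parity-insertion : ∀ {u v} → Insertion m u v → parity (length u) ≡ parity (length v)
    parity-insertion (insert p q i j) = parity-prefix p (parity-relator i j (m i j) q)

  len-s≢ : ∀ i w → len (s i ∙ w) ≢ len w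
  len-s≢ i w eq with hasWord-len w | hasWord-len (s i ∙ w)
  ... | u , l , e | v , l′ , e′ = ℙₚ.p≢p⁻¹ (parity (suc (len w)))
    (≡.trans (≡.sym (≡.cong (parity ∘ suc) l))
    (≡.trans (parity-eval (i ∷ u) v (trans (∙-congˡ e) (sym e′)))
    (≡.trans (≡.cong parity (≡.trans l′ eq))
             (≡.sym (ℙₚ.suc-homo-⁻¹ (len w))))))

  ascent⊎descent : ∀ i w → len w ℕ.< len (s i ∙ w) ⊎ len (s i ∙ w) ℕ.< len w
  ascent⊎descent i w with ℕₚ.<-cmp (len w) (len (s i ∙ w))
  ... | tri< asc _ _ = inj₁ asc
  ... | tri≈ _ eq _  = ⊥-elim (len-s≢ i w (≡.sym eq))
  ... | tri> _ _ des = inj₂ des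

  ascent-len : ∀ {i w} → len w ℕ.< len (s i ∙ w) → len (s i ∙ w) ≡ suc (len w)
  ascent-len {i} {w} asc = ℕₚ.≤-antisym (len-s-∙ i w) asc

  descent-len : ∀ {i w} → len (s i ∙ w) ℕ.< len w → len w ≡ suc (len (s i ∙ w))
  descent-len {i} {w} des = ℕₚ.≤-antisym
    (ℕₚ.≤-trans (ℕₚ.≤-reflexive (≡.sym (len-cong (s-cancel i w)))) (len-s-∙ i (s i ∙ w))) des

  exists-descent : ∀ w → w ≈ ε ⊎ ∃ λ i → len (s i ∙ w) ℕ.< len w
  exists-descent w with hasWord-len w
  ... | []    , _ , e = inj₁ (sym e)
  ... | i ∷ v , l , e = inj₂ (i , ≡.subst (len (s i ∙ w) ℕ.<_) l
    (s≤s (len-≤ (v , ≡.refl , trans (sym (s-cancel i (eval v))) (∙-congˡ e)))))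

  longest : ∃ λ w₀ → ∀ w → len w ℕ.≤ len w₀
  longest = argmax len ε elements , λ w → ℕₚ.≤-trans
    (ℕₚ.≤-reflexive (len-cong (sym (Inverse.strictlyInverseʳ finite w))))
    (All.lookup (f[xs]≤f[argmax] {f = len} ε elements) (∈-map⁺ (Inverse.from finite) (∈-allFin (Inverse.to finite w))))
    where
    elements : List Carrier
    elements = map (Inverse.from finite) (allFin order)

  altWord : Fin n → Fin n → ℕ → List (Fin n)
  altWord a b zero    = []
  altWord a b (suc k) = a ∷ altWord b a k

  -- The inverse of `eval (altWord a b k)`, built at its right end so that it can absorb the first
  -- letter of a following factor: x v = (x s_b)(s_b v).
  alt⁻¹ : Fin n → Fin n → ℕ → Carrier
  alt⁻¹ a b zero    = ε
  alt⁻¹ a b (suc k) = alt⁻¹ b a k ∙ s a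

  alt⁻¹-inverse : ∀ a b k → alt⁻¹ a b k ∙ eval (altWord a b k) ≈ ε
  alt⁻¹-inverse a b zero    = identityˡ ε
  alt⁻¹-inverse a b (suc k) = begin
    (alt⁻¹ b a k ∙ s a) ∙ (s a ∙ eval (altWord b a k))  ≈⟨ assoc _ _ _ ⟩
    alt⁻¹ b a k ∙ (s a ∙ (s a ∙ eval (altWord b a k)))  ≈⟨ ∙-congˡ (s-cancel a _) ⟩
    alt⁻¹ b a k ∙ eval (altWord b a k)                  ≈⟨ alt⁻¹-inverse b a k ⟩
    ε                                                   ∎

  len-alt⁻¹-∙ : ∀ a b k w → len (alt⁻¹ a b k ∙ w) ℕ.≤ k ℕ.+ len w
  len-alt⁻¹-∙ a b zero    w = ℕₚ.≤-reflexive (len-cong (identityˡ w))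
  len-alt⁻¹-∙ a b (suc k) w = ℕₚ.≤-trans (ℕₚ.≤-reflexive (len-cong (assoc _ _ _)))
    (ℕₚ.≤-trans (len-alt⁻¹-∙ b a k (s a ∙ w))
      (ℕₚ.≤-trans (ℕₚ.+-monoʳ-≤ k (len-s-∙ a w)) (ℕₚ.≤-reflexive (ℕₚ.+-suc k (len w)))))

  altWord-split : ∀ a b p q → ∃ λ u → length u ≡ q × eval (altWord a b (p ℕ.+ q)) ≈ eval (altWord a b p) ∙ eval u
  altWord-split a b zero q = altWord a b q , length-altWord a b q , sym (identityˡ _)
    where
    length-altWord : ∀ a b k → length (altWord a b k) ≡ k
    length-altWord a b zero    = ≡.refl
    length-altWord a b (suc k) = ≡.cong suc (length-altWord b a k)
  altWord-split a b (suc p) q with altWord-split b a p q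
  ... | u , l , e = u , l , trans (∙-congˡ e) (sym (assoc _ _ _))

  altWord-even : ∀ a b k → altWord a b (k ℕ.* 2) ≡ relator a b k
  altWord-even a b zero    = ≡.refl
  altWord-even a b (suc k) = ≡.cong (λ u → a ∷ b ∷ u) (altWord-even a b k)

  -- The braid relation turns the alternating word of length m + 1 into one of length m - 1.
  long-alternation : ∀ {a b} → a ≢ b → ∀ w → len (alt⁻¹ a b (suc (m a b)) ∙ w) ℕ.< m a b ℕ.+ len w
  long-alternation {a} {b} a≢b w with m a b in eq | offDiagonal a≢b
  ... | suc m′ | _ with altWord-split a b (suc (suc m′)) m′
  ...   | u , l , e = s≤s (ℕₚ.≤-trans (ℕₚ.≤-reflexive (len-cong (∙-congʳ shorter)))
                          (ℕₚ.≤-trans (len-eval-∙ u w) (ℕₚ.≤-reflexive (≡.cong (ℕ._+ len w) l))))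
    where
    x = alt⁻¹ a b (suc (suc m′))
    y = eval (altWord a b (suc (suc m′)))
    double : suc (suc m′) ℕ.+ m′ ≡ m a b ℕ.* 2
    double = ≡.trans (≡.cong (λ k → suc (suc k)) (≡.trans (≡.cong (m′ ℕ.+_) (≡.sym (ℕₚ.+-identityʳ m′))) (ℕₚ.*-comm 2 m′)))
                     (≡.cong (ℕ._* 2) (≡.sym eq))
    y∙u≈ε : y ∙ eval u ≈ ε
    y∙u≈ε = begin
      y ∙ eval u                                ≈⟨ e ⟨
      eval (altWord a b (suc (suc m′) ℕ.+ m′))  ≡⟨ ≡.cong eval (≡.trans (≡.cong (altWord a b) double) (altWord-even a b (m a b))) ⟩
      eval (relator a b (m a b))                ≈⟨ eval-relator a b ⟩
      ε                                         ∎
    shorter : x ≈ eval u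
    shorter = begin
      x                   ≈⟨ identityʳ x ⟨
      x ∙ ε               ≈⟨ ∙-congˡ y∙u≈ε ⟨
      x ∙ (y ∙ eval u)    ≈⟨ assoc _ _ _ ⟨
      (x ∙ y) ∙ eval u    ≈⟨ ∙-congʳ (alt⁻¹-inverse a b (suc (suc m′))) ⟩
      ε ∙ eval u          ≈⟨ identityˡ _ ⟩
      eval u              ∎

-- The geometric representation: the action respects the relations.

module Representation {n : ℕ} {c ℓ a ℓ₁ ℓ₂ : Level}
                      (C : FiniteCoxeterSystem n c ℓ) (K : OrderedField a ℓ₁ ℓ₂)
                      (cosπ/ : ℕ → OrderedField.Carrier K)
                      (isCosπ/ : ∀ {i j} → i ≢ j →
                         Cosine.IsCosπ/ K (FiniteCoxeterSystem.m C i j) (cosπ/ (FiniteCoxeterSystem.m C i j)))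
                      where
  private module G = FiniteCoxeterSystem C
  open FiniteCoxeterSystem C using (m; isCoxeterMatrix; eval; presentation; generated) renaming (Carrier to W; _∙_ to infixl 7 _∙_; _⁻¹ to infix 8 _⁻¹)
  open IsCoxeterMatrix isCoxeterMatrix
  open CoxeterGroup C
  open Length C using (relator)
  open RootSystem C K cosπ/
  open OrderedField K hiding (zero) renaming (_<_ to infix 4 _<_)
  open FieldProperties K
  open import Algebra.Properties.Semiring.Sum semiring
  open import Relation.Binary.Reasoning.Setoid setoid

  record IsLinear (f : V → Carrier) : Set (a ⊔ ℓ₁) where
    field
      cong  : ∀ {u v} → u ≋ v → f u ≈ f v
      add   : ∀ u v → f (λ k → u k + v k) ≈ f u + f v
      scale : ∀ t v → f (λ k → t * v k) ≈ t * f v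

    sub-scale : ∀ u t v → f (λ k → u k - t * v k) ≈ f u - t * f v
    sub-scale u t v = begin
      f (λ k → u k - t * v k)         ≈⟨ cong (λ k → solve 3 (λ u t v → u :- t :* v := u :+ (:- t) :* v) refl (u k) t (v k)) ⟩
      f (λ k → u k + - t * v k)       ≈⟨ add u _ ⟩
      f u + f (λ k → - t * v k)       ≈⟨ +-congˡ (scale (- t) v) ⟩
      f u + - t * f v                 ≈⟨ solve 3 (λ u t v → u :- t :* v := u :+ (:- t) :* v) refl (f u) t (f v) ⟨
      f u - t * f v                   ∎

    zero-homo : f (λ _ → 0#) ≈ 0#
    zero-homo = begin
      f (λ _ → 0#)        ≈⟨ cong (λ _ → zeroˡ 0#) ⟨
      f (λ _ → 0# * 0#)   ≈⟨ scale 0# _ ⟩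
      0# * f (λ _ → 0#)   ≈⟨ zeroˡ _ ⟩
      0#                  ∎

    neg-homo : ∀ v → f (λ k → - v k) ≈ - f v
    neg-homo v = begin
      f (λ k → - v k)             ≈⟨ cong (λ k → solve 1 (λ x → :- x := :0 :- :1 :* x) refl (v k)) ⟩
      f (λ k → 0# - 1# * v k)     ≈⟨ sub-scale _ 1# v ⟩
      f (λ _ → 0#) - 1# * f v     ≈⟨ +-congʳ zero-homo ⟩
      0# - 1# * f v               ≈⟨ solve 1 (λ x → :- x := :0 :- :1 :* x) refl (f v) ⟨
      - f v                       ∎

    sum-homo : ∀ {p} (g : Fin p → V) → f (λ k → sum λ i → g i k) ≈ sum (λ i → f (g i))
    sum-homo {zero}  g = zero-homo
    sum-homo {suc p} g = trans (add (g zero) _) (+-congˡ (sum-homo (g ∘ suc)))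

  open IsLinear

  IsLinearMap : (V → V) → Set (a ⊔ ℓ₁)
  IsLinearMap L = ∀ k → IsLinear (λ v → L v k)

  linear-coordinate : ∀ t k → IsLinear (λ v → t * v k)
  linear-coordinate t k = record
    { cong  = λ u≋v → *-congˡ (u≋v k)
    ; add   = λ u v → distribˡ t (u k) (v k)
    ; scale = λ r v → solve 3 (λ t r x → t :* (r :* x) := r :* (t :* x)) refl t r (v k)
    }

  linear-sum : ∀ {p} {f : Fin p → V → Carrier} → (∀ i → IsLinear (f i)) → IsLinear (λ v → sum λ i → f i v)
  linear-sum {f = f} lin = record
    { cong  = λ u≋v → sum-cong-≋ (λ i → cong (lin i) u≋v)
    ; add   = λ u v → trans (sum-cong-≋ (λ i → add (lin i) u v)) (∑-distrib-+ (λ i → f i u) (λ i → f i v))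
    ; scale = λ t v → trans (sum-cong-≋ (λ i → scale (lin i) t v)) (sym (*-distribˡ-sum t (λ i → f i v)))
    }

  linear-∘ : ∀ {f L} → IsLinear f → IsLinearMap L → IsLinear (f ∘ L)
  linear-∘ f-lin L-lin = record
    { cong  = λ u≋v → cong f-lin (λ k → cong (L-lin k) u≋v)
    ; add   = λ u v → trans (cong f-lin (λ k → add (L-lin k) u v)) (add f-lin _ _)
    ; scale = λ t v → trans (cong f-lin (λ k → scale (L-lin k) t v)) (scale f-lin t _)
    }

  sum-zero : ∀ {p} (t : Fin p → Carrier) → (∀ i → t i ≈ 0#) → sum t ≈ 0#
  sum-zero {p} t t≈0 = trans (sum-cong-≋ t≈0) (sum-replicate-zero p)

  sum-single : ∀ {p} (t : Fin p → Carrier) k → (∀ i → i ≢ k → t i ≈ 0#) → sum t ≈ t k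
  sum-single {suc p} t k t≈0 = begin
    sum t                            ≈⟨ sum-remove {i = k} t ⟩
    t k + sum (λ i → t (punchIn k i)) ≈⟨ +-congˡ (sum-zero _ (λ i → t≈0 (punchIn k i) (punchInᵢ≢i k i))) ⟩
    t k + 0#                         ≈⟨ +-identityʳ (t k) ⟩
    t k                              ∎

  δ-same : ∀ i → δ i i ≈ 1#
  δ-same i with i ≟ᶠ i
  ... | yes _  = refl
  ... | no i≢i = ⊥-elim (i≢i ≡.refl)

  δ-other : ∀ {i j} → i ≢ j → δ i j ≈ 0#
  δ-other {i} {j} i≢j with i ≟ᶠ j
  ... | yes i≡j = ⊥-elim (i≢j i≡j)
  ... | no _    = refl

  gram-same : ∀ i → gram i i ≈ 1#
  gram-same i with i ≟ᶠ i
  ... | yes _  = refl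
  ... | no i≢i = ⊥-elim (i≢i ≡.refl)

  gram-other : ∀ {i j} → i ≢ j → gram i j ≈ - cosπ/ (m i j)
  gram-other {i} {j} i≢j with i ≟ᶠ j
  ... | yes i≡j = ⊥-elim (i≢j i≡j)
  ... | no _    = refl

  linear-expansion : ∀ {f} → IsLinear f → ∀ v → f v ≈ sum (λ i → v i * f (α i))
  linear-expansion {f} lin v = begin
    f v                                   ≈⟨ cong lin coordinates ⟩
    f (λ k → sum (λ i → v i * α i k))     ≈⟨ sum-homo lin (λ i k → v i * α i k) ⟩
    sum (λ i → f (λ k → v i * α i k))     ≈⟨ sum-cong-≋ (λ i → scale lin (v i) (α i)) ⟩
    sum (λ i → v i * f (α i))             ∎
    where
    coordinates : v ≋ (λ k → sum (λ i → v i * α i k))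
    coordinates k = sym (trans (sum-single _ k (λ i i≢k → trans (*-congˡ (δ-other i≢k)) (zeroʳ (v i))))
                               (trans (*-congˡ (δ-same k)) (*-identityʳ (v k))))

  B-linear : ∀ u → IsLinear (B u)
  B-linear u = linear-sum (λ i → linear-sum (λ j → linear-coordinate (u i * gram i j) j))

  B-simple : ∀ i j → B (α i) (α j) ≈ gram i j
  B-simple i j = begin
    B (α i) (α j)
      ≈⟨ sum-single (λ k → sum (λ l → δ i k * gram k l * δ j l)) i (λ k k≢i → sum-zero (λ l → δ i k * gram k l * δ j l) (λ l →
           trans (*-congʳ (trans (*-congʳ (δ-other (k≢i ∘ ≡.sym))) (zeroˡ _))) (zeroˡ _))) ⟩
    sum (λ l → δ i i * gram i l * δ j l)
      ≈⟨ sum-single (λ l → δ i i * gram i l * δ j l) j (λ l l≢j → trans (*-congˡ (δ-other (l≢j ∘ ≡.sym))) (zeroʳ _)) ⟩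
    δ i i * gram i j * δ j j
      ≈⟨ *-cong (*-congʳ (δ-same i)) (δ-same j) ⟩
    1# * gram i j * 1#
      ≈⟨ solve 1 (λ x → :1 :* x :* :1 := x) refl (gram i j) ⟩
    gram i j ∎

  coroot : Fin n → V → Carrier
  coroot i v = B (α i) v + B (α i) v

  coroot-linear : ∀ i → IsLinear (coroot i)
  coroot-linear i = record
    { cong  = λ u≋v → +-cong (cong lin u≋v) (cong lin u≋v)
    ; add   = λ u v → trans (+-cong (add lin u v) (add lin u v))
                (solve 2 (λ x y → (x :+ y) :+ (x :+ y) := (x :+ x) :+ (y :+ y)) refl (B (α i) u) (B (α i) v))
    ; scale = λ t v → trans (+-cong (scale lin t v) (scale lin t v)) (sym (distribˡ t _ _))
    }
    where lin = B-linear (α i)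

  coroot-same : ∀ i → coroot i (α i) ≈ 1# + 1#
  coroot-same i = +-cong eq eq
    where
    eq = trans (B-simple i i) (gram-same i)

  coroot-other : ∀ {i j} → i ≢ j → coroot i (α j) ≈ - (cosπ/ (m i j) + cosπ/ (m i j))
  coroot-other {i} {j} i≢j = trans (+-cong eq eq) (solve 1 (λ x → :- x :- x := :- (x :+ x)) refl (cosπ/ (m i j)))
    where
    eq = trans (B-simple i j) (gram-other i≢j)

  reflection-linear : ∀ i → IsLinearMap (reflection i)
  reflection-linear i k = record
    { cong  = λ u≋v → +-cong (u≋v k) (-‿cong (*-congʳ (cong lin u≋v)))
    ; add   = λ u v → trans (+-congˡ (-‿cong (*-congʳ (add lin u v))))
                (solve 5 (λ x y z w d → x :+ y :- (z :+ w) :* d := (x :- z :* d) :+ (y :- w :* d)) refl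
                  (u k) (v k) (coroot i u) (coroot i v) (α i k))
    ; scale = λ t v → trans (+-congˡ (-‿cong (*-congʳ (scale lin t v))))
                (solve 4 (λ t x z d → t :* x :- t :* z :* d := t :* (x :- z :* d)) refl t (v k) (coroot i v) (α i k))
    }
    where lin = coroot-linear i

  coroot-reflection : ∀ i j v → coroot i (reflection j v) ≈ coroot i v - coroot j v * coroot i (α j)
  coroot-reflection i j v = sub-scale (coroot-linear i) v (coroot j v) (α j)

  reflection-involutive : ∀ i v → reflection i (reflection i v) ≋ v
  reflection-involutive i v k = begin
    (v k - t * α i k) - coroot i (reflection i v) * α i k
      ≈⟨ +-congˡ (-‿cong (*-congʳ (trans (coroot-reflection i i v) (+-congˡ (-‿cong (*-congˡ (coroot-same i))))))) ⟩
    (v k - t * α i k) - (t - t * (1# + 1#)) * α i k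
      ≈⟨ solve 3 (λ x t d → (x :- t :* d) :- (t :- t :* (:1 :+ :1)) :* d := x) refl (v k) t (α i k) ⟩
    v k ∎
    where t = coroot i v

  reflection-simple : ∀ i → reflection i (α i) ≋ (λ k → - α i k)
  reflection-simple i k = begin
    α i k - coroot i (α i) * α i k  ≈⟨ +-congˡ (-‿cong (*-congʳ (coroot-same i))) ⟩
    α i k - (1# + 1#) * α i k       ≈⟨ solve 1 (λ d → d :- (:1 :+ :1) :* d := :- d) refl (α i k) ⟩
    - α i k                         ∎

  reflection-simple-other : ∀ {i j} → i ≢ j → ∀ k →
    reflection j (α i) k ≈ α i k + (cosπ/ (m i j) + cosπ/ (m i j)) * α j k
  reflection-simple-other {i} {j} i≢j k = begin
    α i k - coroot j (α i) * α j k    ≈⟨ +-congˡ (-‿cong (*-congʳ (coroot-other (i≢j ∘ ≡.sym)))) ⟩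
    α i k - - (x + x) * α j k         ≈⟨ solve 3 (λ y d e → d :- (:- (y :+ y)) :* e := d :+ (y :+ y) :* e) refl x (α i k) (α j k) ⟩
    α i k + (x + x) * α j k           ≈⟨ +-congˡ (*-congʳ (reflexive (≡.cong (λ l → cosπ/ l + cosπ/ l) (symmetric j i)))) ⟩
    _ ∎
    where x = cosπ/ (m j i)

  actWord : List (Fin n) → V → V
  actWord u v = foldr reflection v u

  actWord-linear : ∀ u → IsLinearMap (actWord u)
  actWord-linear []      k = record { cong = λ u≋v → u≋v k ; add = λ _ _ → refl ; scale = λ _ _ → refl }
  actWord-linear (i ∷ u) k = linear-∘ (reflection-linear i k) (actWord-linear u)

  -- The vectors (s_i s_j)^k v differ from v by elements of the plane spanned by
  -- α_i and α_j, and for k = m i j they have the same products with α_i and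
  -- α_j as v; nondegeneracy of the plane makes the difference vanish.
  module _ {i j : Fin n} (i≢j : i ≢ j) where
    private
      cos : Carrier
      cos = cosπ/ (m i j)

      open SinRatio cos

      coroot-ij : coroot i (α j) ≈ - (cos + cos)
      coroot-ij = coroot-other i≢j

      coroot-ji : coroot j (α i) ≈ - (cos + cos)
      coroot-ji = trans (coroot-other (i≢j ∘ ≡.sym)) (reflexive (≡.cong (λ l → - (cosπ/ l + cosπ/ l)) (symmetric j i)))

      orbit : ∀ k v → ∃₂ λ p q → ∀ l → actWord (relator i j k) v l ≈ v l + p * α i l + q * α j l
      orbit zero    v = 0# , 0# , λ l → solve 3 (λ x d e → x := x :+ :0 :* d :+ :0 :* e) refl (v l) (α i l) (α j l)
      orbit (suc k) v with orbit k v
      ... | p , q , eq = p - coroot i (reflection j u) , q - coroot j u , λ l → begin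
        (u l - coroot j u * α j l) - coroot i (reflection j u) * α i l
          ≈⟨ +-congʳ (+-congʳ (eq l)) ⟩
        (v l + p * α i l + q * α j l - coroot j u * α j l) - coroot i (reflection j u) * α i l
          ≈⟨ solve 7 (λ x p q y z d e → (x :+ p :* d :+ q :* e :- y :* e) :- z :* d := x :+ (p :- z) :* d :+ (q :- y) :* e)
               refl (v l) p q (coroot j u) (coroot i (reflection j u)) (α i l) (α j l) ⟩
        v l + (p - coroot i (reflection j u)) * α i l + (q - coroot j u) * α j l ∎
        where u = actWord (relator i j k) v

      -- Powers of the rotation s_i s_j, read off on the two coroots. The coefficient `U (suc (k ℕ.*
      -- 2)) - (cos + cos) * U (k ℕ.* 2)` is - U(2k-1), written so that k = 0 causes no negative
      -- index.
      coroot-orbit : ∀ k v →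
        coroot j (actWord (relator i j k) v) ≈ U (suc (k ℕ.* 2)) * coroot j v + U (k ℕ.* 2) * coroot i v ×
        coroot i (actWord (relator i j k) v) ≈ (U (suc (k ℕ.* 2)) - (cos + cos) * U (k ℕ.* 2)) * coroot i v - U (k ℕ.* 2) * coroot j v
      coroot-orbit zero    v =
        solve 2 (λ x y → x := :1 :* x :+ :0 :* y) refl (coroot j v) (coroot i v) ,
        solve 3 (λ x y c → y := (:1 :- (c :+ c) :* :0) :* y :- :0 :* x) refl (coroot j v) (coroot i v) cos
      coroot-orbit (suc k) v with coroot-orbit k v
      ... | eqⱼ , eqᵢ = (begin
          coroot j (reflection i (reflection j u))
            ≈⟨ coroot-reflection j i (reflection j u) ⟩
          coroot j (reflection j u) - coroot i (reflection j u) * coroot j (α i)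
            ≈⟨ +-cong on-j (-‿cong (*-cong on-i coroot-ji)) ⟩
          - X - (Y + (cos + cos) * X) * - (cos + cos)
            ≈⟨ solve 5 (λ c x y g h → :- (x :* g :+ y :* h) :- (((x :- (c :+ c) :* y) :* h :- y :* g) :+ (c :+ c) :* (x :* g :+ y :* h)) :* (:- (c :+ c))
                 := ((c :+ c) :* ((c :+ c) :* x :- y) :- x) :* g :+ ((c :+ c) :* x :- y) :* h) refl cos x y g h ⟩
          U (suc (suc k ℕ.* 2)) * g + U (suc k ℕ.* 2) * h ∎) ,
        (begin
          coroot i (reflection i (reflection j u))
            ≈⟨ coroot-reflection i i (reflection j u) ⟩
          coroot i (reflection j u) - coroot i (reflection j u) * coroot i (α i)
            ≈⟨ +-cong on-i (-‿cong (*-cong on-i (coroot-same i))) ⟩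
          (Y + (cos + cos) * X) - (Y + (cos + cos) * X) * (1# + 1#)
            ≈⟨ solve 5 (λ c x y g h → let z = ((x :- (c :+ c) :* y) :* h :- y :* g) :+ (c :+ c) :* (x :* g :+ y :* h)
                                          w = (c :+ c) :* x :- y in
                 z :- z :* (:1 :+ :1) := (((c :+ c) :* w :- x) :- (c :+ c) :* w) :* h :- w :* g) refl cos x y g h ⟩
          (U (suc (suc k ℕ.* 2)) - (cos + cos) * U (suc k ℕ.* 2)) * h - U (suc k ℕ.* 2) * g ∎)
        where
        u = actWord (relator i j k) v
        g = coroot j v
        h = coroot i v
        x = U (suc (k ℕ.* 2))
        y = U (k ℕ.* 2)
        X = x * g + y * h
        Y = (x - (cos + cos) * y) * h - y * g
        on-i : coroot i (reflection j u) ≈ Y + (cos + cos) * X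
        on-i = begin
          coroot i (reflection j u)                ≈⟨ coroot-reflection i j u ⟩
          coroot i u - coroot j u * coroot i (α j) ≈⟨ +-cong eqᵢ (-‿cong (*-cong eqⱼ coroot-ij)) ⟩
          Y - X * - (cos + cos)                    ≈⟨ solve 3 (λ y x c → y :- x :* (:- (c :+ c)) := y :+ (c :+ c) :* x) refl Y X cos ⟩
          Y + (cos + cos) * X                      ∎
        on-j : coroot j (reflection j u) ≈ - X
        on-j = begin
          coroot j (reflection j u)                ≈⟨ coroot-reflection j j u ⟩
          coroot j u - coroot j u * coroot j (α j) ≈⟨ +-cong eqⱼ (-‿cong (*-cong eqⱼ (coroot-same j))) ⟩
          X - X * (1# + 1#)                        ≈⟨ solve 1 (λ x → x :- x :* (:1 :+ :1) := :- x) refl X ⟩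
          - X                                      ∎

    private
      halve : ∀ {x y} → x + x ≈ (cos + cos) * y → x ≈ cos * y
      halve {x} {y} eq = begin
        x                         ≈⟨ solve 2 (λ x z → x := (x :- z) :+ z) refl x (cos * y) ⟩
        (x - cos * y) + cos * y   ≈⟨ +-congʳ (pos-cancel (pos-+ 0<1 (pos⇒NonNeg 0<1)) (begin
          (1# + 1#) * (x - cos * y)     ≈⟨ solve 3 (λ c x y → (:1 :+ :1) :* (x :- c :* y) := (x :+ x) :- (c :+ c) :* y) refl cos x y ⟩
          (x + x) - (cos + cos) * y     ≈⟨ +-congʳ eq ⟩
          (cos + cos) * y - (cos + cos) * y ≈⟨ -‿inverseʳ _ ⟩
          0# ∎)) ⟩
        0# + cos * y              ≈⟨ +-identityˡ _ ⟩
        cos * y                   ∎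

      displacement-trivial : ∀ {M m′ u v} → M ≡ suc (suc m′) → Cosine.IsCosπ/ K M cos →
        ∀ p q → (∀ l → u l ≈ v l + p * α i l + q * α j l) →
        coroot i u ≈ coroot i v → coroot j u ≈ coroot j v → u ≋ v
      displacement-trivial {u = u} {v} M≡ isCos p q eq eqᵢ eqⱼ l = begin
        u l                            ≈⟨ eq l ⟩
        v l + p * α i l + q * α j l    ≈⟨ +-cong (+-congˡ (*-congʳ (radical-trivial M≡ isCos p≈ q≈))) (*-congʳ (radical-trivial M≡ isCos q≈ p≈)) ⟩
        v l + 0# * α i l + 0# * α j l  ≈⟨ solve 3 (λ x d e → x :+ :0 :* d :+ :0 :* e := x) refl (v l) (α i l) (α j l) ⟩
        v l                            ∎
        where
        orthogonal : ∀ k → coroot k u ≈ coroot k v → p * coroot k (α i) + q * coroot k (α j) ≈ 0#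
        orthogonal k u≈v = begin
          p * coroot k (α i) + q * coroot k (α j)
            ≈⟨ solve 3 (λ x y z → y :+ z := (x :+ y :+ z) :- x) refl (coroot k v) (p * coroot k (α i)) (q * coroot k (α j)) ⟩
          (coroot k v + p * coroot k (α i) + q * coroot k (α j)) - coroot k v
            ≈⟨ +-congʳ (+-cong (+-congˡ (scale lin p (α i))) (scale lin q (α j))) ⟨
          (coroot k v + coroot k (λ l → p * α i l) + coroot k (λ l → q * α j l)) - coroot k v
            ≈⟨ +-congʳ (+-congʳ (add lin v (λ l → p * α i l))) ⟨
          (coroot k (λ l → v l + p * α i l) + coroot k (λ l → q * α j l)) - coroot k v
            ≈⟨ +-congʳ (add lin (λ l → v l + p * α i l) (λ l → q * α j l)) ⟨
          coroot k (λ l → v l + p * α i l + q * α j l) - coroot k v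
            ≈⟨ +-congʳ (trans (sym (cong lin eq)) u≈v) ⟩
          coroot k v - coroot k v
            ≈⟨ -‿inverseʳ _ ⟩
          0# ∎
          where lin = coroot-linear k
        p≈ : p ≈ cos * q
        -- Pairing the displacement p α_i + q α_j with the coroot of α_i gives 2p - 2 cos q = 0; the
        -- coroot of α_j gives the symmetric equation.
        p≈ = halve (begin
          p + p
            ≈⟨ solve 3 (λ c p q → p :+ p := (p :* (:1 :+ :1) :+ q :* (:- (c :+ c))) :+ (c :+ c) :* q) refl cos p q ⟩
          (p * (1# + 1#) + q * - (cos + cos)) + (cos + cos) * q
            ≈⟨ +-congʳ (+-cong (*-congˡ (coroot-same i)) (*-congˡ coroot-ij)) ⟨
          (p * coroot i (α i) + q * coroot i (α j)) + (cos + cos) * q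
            ≈⟨ +-congʳ (orthogonal i eqᵢ) ⟩
          0# + (cos + cos) * q
            ≈⟨ +-identityˡ _ ⟩
          (cos + cos) * q ∎)
        q≈ : q ≈ cos * p
        q≈ = halve (begin
          q + q
            ≈⟨ solve 3 (λ c p q → q :+ q := (p :* (:- (c :+ c)) :+ q :* (:1 :+ :1)) :+ (c :+ c) :* p) refl cos p q ⟩
          (p * - (cos + cos) + q * (1# + 1#)) + (cos + cos) * p
            ≈⟨ +-congʳ (+-cong (*-congˡ coroot-ji) (*-congˡ (coroot-same j))) ⟨
          (p * coroot j (α i) + q * coroot j (α j)) + (cos + cos) * p
            ≈⟨ +-congʳ (orthogonal j eqⱼ) ⟩
          0# + (cos + cos) * p
            ≈⟨ +-identityˡ _ ⟩
          (cos + cos) * p ∎)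

    relator-trivial-≢ : ∀ v → actWord (relator i j (m i j)) v ≋ v
    relator-trivial-≢ v = displacement-trivial m≡ isCos _ _ (proj₂ (proj₂ (orbit (m i j) v)))
      (trans (proj₂ (coroot-orbit (m i j) v))
        (trans (+-cong (*-congʳ (+-cong U≈1 (-‿cong (*-congˡ U≈0)))) (-‿cong (*-congʳ U≈0)))
               (solve 3 (λ c x y → (:1 :- (c :+ c) :* :0) :* x :- :0 :* y := x) refl cos (coroot i v) (coroot j v))))
      (trans (proj₁ (coroot-orbit (m i j) v))
        (trans (+-cong (*-congʳ U≈1) (*-congʳ U≈0))
               (solve 2 (λ x y → :1 :* x :+ :0 :* y := x) refl (coroot j v) (coroot i v))))
      where
      m≡ = ≡.sym (proj₂ (ℕₚ.m≤n⇒∃[o]m+o≡n (offDiagonal i≢j)))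
      isCos = isCosπ/ i≢j
      U≈0 = proj₁ (sinRatio-full-turn m≡ isCos)
      U≈1 = proj₂ (sinRatio-full-turn m≡ isCos)

  relator-trivial : ∀ i j v → actWord (relator i j (m i j)) v ≋ v
  relator-trivial i j with i ≟ᶠ j
  ... | no i≢j     = relator-trivial-≢ i≢j
  ... | yes ≡.refl with m i i | diagonal i
  ...   | _ | ≡.refl = reflection-involutive i

  actWord-cong : ∀ u {v w} → v ≋ w → actWord u v ≋ actWord u w
  actWord-cong u v≋w k = cong (actWord-linear u k) v≋w

  actWord-++ : ∀ p q v → actWord (p ++ q) v ≡ actWord p (actWord q v)
  actWord-++ p q v = foldr-++ reflection v p q

  actWord-insertion : ∀ {u u′} → Insertion m u u′ → ∀ v → actWord u v ≋ actWord u′ v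
  actWord-insertion (insert p q i j) v k = begin
    actWord (p ++ q) v k                         ≡⟨ ≡.cong-app (actWord-++ p q v) k ⟩
    actWord p (actWord q v) k                    ≈⟨ actWord-cong p (relator-trivial i j (actWord q v)) k ⟨
    actWord p (actWord r (actWord q v)) k        ≡⟨ ≡.cong-app (≡.cong (actWord p) (actWord-++ r q v)) k ⟨
    actWord p (actWord (r ++ q) v) k             ≡⟨ ≡.cong-app (actWord-++ p (r ++ q) v) k ⟨
    actWord (p ++ r ++ q) v k                    ∎
    where r = relator i j (m i j)

  -- By `presentation`, equal values are linked by insertions of relators, and each insertion acts
  -- trivially; thus the action descends from words to W.
  actWord-eval : ∀ u u′ → eval u G.≈ eval u′ → ∀ v → actWord u v ≋ actWord u′ v
  actWord-eval u u′ eq = EqClosure.fold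
    (record { refl = λ _ _ → refl ; sym = λ f v k → sym (f v k) ; trans = λ f g v k → trans (f v k) (g v k) })
    actWord-insertion (Equivalence.to (presentation u u′) eq)

  eval-++ : ∀ p q → eval (p ++ q) G.≈ eval p ∙ eval q
  eval-++ []      q = G.sym (G.identityˡ _)
  eval-++ (i ∷ p) q = G.trans (G.∙-congˡ (eval-++ p q)) (G.sym (G.assoc _ _ _))

  eval-reducedWord : ∀ w → eval (reducedWord w) G.≈ w
  eval-reducedWord w = proj₂ (proj₂ (proj₁ (proj₂ (shortest w))))

  act-word : ∀ {w} u → eval u G.≈ w → ∀ v → act w v ≋ actWord u v
  act-word {w} u eq = actWord-eval (reducedWord w) u (G.trans (eval-reducedWord w) (G.sym eq))

  act-linear : ∀ w → IsLinearMap (act w)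
  act-linear w = actWord-linear (reducedWord w)

  act-congʳ : ∀ w {u v} → u ≋ v → act w u ≋ act w v
  act-congʳ w = actWord-cong (reducedWord w)

  act-congˡ : ∀ {w w′} → w G.≈ w′ → ∀ v → act w v ≋ act w′ v
  act-congˡ {w′ = w′} w≈w′ = act-word (reducedWord w′) (G.trans (eval-reducedWord w′) (G.sym w≈w′))

  act-∙ : ∀ w w′ v → act (w ∙ w′) v ≋ act w (act w′ v)
  act-∙ w w′ v k = begin
    act (w ∙ w′) v k
      ≈⟨ act-word (reducedWord w ++ reducedWord w′) (G.trans
           (eval-++ (reducedWord w) (reducedWord w′)) (G.∙-cong (eval-reducedWord w) (eval-reducedWord w′))) v k ⟩
    actWord (reducedWord w ++ reducedWord w′) v k
      ≡⟨ ≡.cong-app (actWord-++ (reducedWord w) (reducedWord w′) v) k ⟩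
    act w (act w′ v) k ∎

  act-ε : ∀ v → act G.ε v ≋ v
  act-ε = act-word [] G.refl

  act-s : ∀ i v → act (G.s i) v ≋ reflection i v
  act-s i = act-word (i ∷ []) (G.identityʳ _)

  act-neg : ∀ w v k → act w (λ l → - v l) k ≈ - act w v k
  act-neg w v k = neg-homo (act-linear w k) v

-- Ascents give positive roots.

module Positivity {n : ℕ} {c ℓ a ℓ₁ ℓ₂ : Level}
                  (C : FiniteCoxeterSystem n c ℓ) (K : OrderedField a ℓ₁ ℓ₂)
                  (cosπ/ : ℕ → OrderedField.Carrier K)
                  (isCosπ/ : ∀ {i j} → i ≢ j →
                     Cosine.IsCosπ/ K (FiniteCoxeterSystem.m C i j) (cosπ/ (FiniteCoxeterSystem.m C i j)))
                  where
  private module G = FiniteCoxeterSystem C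
  open FiniteCoxeterSystem C using (m; s; ε; isCoxeterMatrix) renaming (Carrier to W; _∙_ to infixl 7 _∙_; _⁻¹ to infix 8 _⁻¹)
  open IsCoxeterMatrix isCoxeterMatrix
  open CoxeterGroup C
  open RootSystem C K cosπ/
  open OrderedField K hiding (zero) renaming (_<_ to infix 4 _<_)
  open FieldProperties K
  open Representation C K cosπ/ isCosπ/
  open Length C

  NonNegative : V → Set ℓ₂
  NonNegative v = ∀ k → NonNeg (v k)

  act-⁻¹-s : ∀ i w v → act (w ⁻¹) v ≋ act ((s i ∙ w) ⁻¹) (reflection i v)
  act-⁻¹-s i w v k = trans
    (act-congˡ (G.trans (G.⁻¹-cong (G.sym (s-cancel i w))) (G.trans (⁻¹-anti-homo-∙ (s i) (s i ∙ w)) (G.∙-congˡ (s⁻¹≈s i)))) v k)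
    (trans (act-∙ ((s i ∙ w) ⁻¹) (s i) v k) (act-congʳ ((s i ∙ w) ⁻¹) (act-s i v) k))

  act-⁻¹-simple-same : ∀ i w k → act (w ⁻¹) (α i) k ≈ - act ((s i ∙ w) ⁻¹) (α i) k
  act-⁻¹-simple-same i w k = trans (act-⁻¹-s i w (α i) k)
    (trans (act-congʳ _ (reflection-simple i) k) (act-neg _ (α i) k))

  act-⁻¹-simple-other : ∀ {i j} → i ≢ j → ∀ w k → let x = act ((s j ∙ w) ⁻¹) in
    act (w ⁻¹) (α i) k ≈ x (α i) k + (cosπ/ (m i j) + cosπ/ (m i j)) * x (α j) k
  act-⁻¹-simple-other {i} {j} i≢j w k = trans (act-⁻¹-s j w (α i) k)
    (trans (cong (reflection-simple-other i≢j))
    (trans (add (α i) (λ l → (cosπ/ (m i j) + cosπ/ (m i j)) * α j l)) (+-congˡ (scale _ (α j)))))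
    where open IsLinear (act-linear ((s j ∙ w) ⁻¹) k)

  α-NonNegative : ∀ i → NonNegative (α i)
  α-NonNegative i k with i ≟ᶠ k
  ... | yes _ = pos⇒NonNeg 0<1
  ... | no  _ = NonNeg-0 refl

  PositiveUpTo : ℕ → Set (c ⊔ ℓ₂)
  PositiveUpTo N = ∀ w i → len w ℕ.≤ N → len w ℕ.< len (s i ∙ w) → NonNegative (act (w ⁻¹) (α i))

  -- If w = x v with x alternating in s_a and s_b of length k and len w = k + len v,
  -- then the combination below is w⁻¹ applied to a simple root.  Letters are moved
  -- from v to x until s_a and s_b are both ascents of v; the braid relation keeps
  -- k < m a b, so the coefficients are nonnegative.
  alternating-NonNeg : ∀ {M} d k {a b} v → a ≢ b → M ≡ m a b → k ℕ.+ d ≡ M →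
    PositiveUpTo (len v) → len (alt⁻¹ a b (suc k) ∙ v) ≡ suc k ℕ.+ len v →
    let open SinRatio (cosπ/ M) in
    ∀ l → NonNeg (U (suc k) * act (v ⁻¹) (α a) l + U k * act (v ⁻¹) (α b) l)
  alternating-NonNeg zero k {a} {b} v a≢b M≡ k+0≡M pos reduced
    with ≡.trans (≡.sym (ℕₚ.+-identityʳ k)) (≡.trans k+0≡M M≡)
  ... | ≡.refl = ⊥-elim (ℕₚ.<-irrefl reduced (ℕₚ.m<n⇒m<1+n (long-alternation a≢b v)))
  alternating-NonNeg {M} (suc d) k {a} {b} v a≢b M≡ k+d≡M pos reduced l with ascent⊎descent b v
  ... | inj₁ b-ascent = NonNeg-+
    (NonNeg-* (sinRatio-NonNeg M≡2+ isCos k<M) (pos v a ℕₚ.≤-refl a-ascent l))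
    (NonNeg-* (sinRatio-NonNeg M≡2+ isCos (ℕₚ.<⇒≤ k<M)) (pos v b ℕₚ.≤-refl b-ascent l))
    where
    open SinRatio (cosπ/ M)
    isCos : Cosine.IsCosπ/ K M (cosπ/ M)
    isCos = ≡.subst (λ k → Cosine.IsCosπ/ K k (cosπ/ k)) (≡.sym M≡) (isCosπ/ a≢b)
    M≡2+ : M ≡ suc (suc _)
    M≡2+ = ≡.trans M≡ (≡.sym (proj₂ (ℕₚ.m≤n⇒∃[o]m+o≡n (offDiagonal a≢b))))
    k<M : k ℕ.< M
    k<M = ≡.subst (k ℕ.<_) k+d≡M (ℕₚ.m<m+n k (s≤s z≤n))
    a-ascent : len v ℕ.< len (s a ∙ v)
    a-ascent with ascent⊎descent a v
    ... | inj₁ asc = asc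
    ... | inj₂ des = ⊥-elim (ℕₚ.<-irrefl reduced (s≤s (ℕₚ.≤-trans
      (ℕₚ.≤-reflexive (len-cong (G.assoc (alt⁻¹ b a k) (s a) v)))
      (ℕₚ.≤-trans (len-alt⁻¹-∙ b a k (s a ∙ v)) (ℕₚ.+-monoʳ-≤ k (ℕₚ.<⇒≤ des))))))
  ... | inj₂ b-descent = NonNeg-resp combination
    (alternating-NonNeg d (suc k) (s b ∙ v) (a≢b ∘ ≡.sym) (≡.trans M≡ (symmetric a b))
      (≡.trans (≡.sym (ℕₚ.+-suc k d)) k+d≡M)
      (λ w i w≤ → pos w i (ℕₚ.≤-trans w≤ (ℕₚ.<⇒≤ b-descent)))
      reduced′ l)
    where
    open SinRatio (cosπ/ M)
    reduced′ : len (alt⁻¹ b a (suc (suc k)) ∙ (s b ∙ v)) ≡ suc (suc k) ℕ.+ len (s b ∙ v)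
    reduced′ = ≡.trans (len-cong (G.trans (G.assoc _ _ _) (G.∙-congˡ (s-cancel b v))))
      (≡.trans reduced (≡.trans (≡.cong (suc k ℕ.+_) (descent-len b-descent)) (≡.cong suc (ℕₚ.+-suc k _))))
    x y z : Carrier
    x = cosπ/ M
    y = act ((s b ∙ v) ⁻¹) (α a) l
    z = act ((s b ∙ v) ⁻¹) (α b) l
    -- Moving s_b replaces α_a by α_a + 2 cos α_b and α_b by - α_b; on coefficients this is one step
    -- of the Chebyshev recursion.
    combination : U (suc (suc k)) * z + U (suc k) * y ≈ U (suc k) * act (v ⁻¹) (α a) l + U k * act (v ⁻¹) (α b) l
    combination = trans
      (solve 5 (λ x u t y z → ((x :+ x) :* u :- t) :* z :+ u :* y := u :* (y :+ (x :+ x) :* z) :+ t :* (:- z)) refl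
        x (U (suc k)) (U k) y z)
      (+-cong (*-congˡ (trans (+-congˡ (*-congʳ (reflexive (≡.cong (λ k → cosπ/ k + cosπ/ k) M≡))))
                              (sym (act-⁻¹-simple-other a≢b v l))))
              (*-congˡ (sym (act-⁻¹-simple-same b v l))))

  -- A descent s_j of w differs from the ascent s_i. With w = s_j v, the product s_i s_j v is
  -- reduced and w⁻¹ α_i = v⁻¹ (s_j α_i) is the alternating combination with k = 1. As v is shorter
  -- than w, the induction hypothesis covers all roots arising from v.
  positiveUpTo : ∀ N → PositiveUpTo N
  positiveUpTo N w i w≤N i-ascent l with exists-descent w
  ... | inj₁ w≈ε = NonNeg-resp (sym (trans (act-congˡ (G.trans (G.⁻¹-cong w≈ε) ε⁻¹≈ε) (α i) l) (act-ε (α i) l)))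
                               (α-NonNegative i l)
  ... | inj₂ (j , j-descent) with N
  ...   | zero  = ⊥-elim (ℕₚ.n≮0 (ℕₚ.<-≤-trans j-descent w≤N))
  ...   | suc N = NonNeg-resp combination
    (alternating-NonNeg (proj₁ 1+d) 1 v (i≢j ∘ ≡.sym) ≡.refl (proj₂ 1+d)
      (λ w i w≤v → positiveUpTo N w i (ℕₚ.≤-trans w≤v (ℕₚ.≤-pred (ℕₚ.<-≤-trans j-descent w≤N))))
      reduced l)
    where
    open SinRatio (cosπ/ (m j i))
    v = s j ∙ w
    i≢j : i ≢ j
    i≢j ≡.refl = ℕₚ.<-asym i-ascent j-descent
    1+d : ∃ λ d → 1 ℕ.+ d ≡ m j i
    1+d = ℕₚ.m≤n⇒∃[o]m+o≡n (ℕₚ.<⇒≤ (offDiagonal (i≢j ∘ ≡.sym)))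
    reduced : len (alt⁻¹ j i 2 ∙ v) ≡ 2 ℕ.+ len v
    reduced = ≡.trans (len-cong (G.trans (G.assoc _ _ _) (G.∙-cong (G.identityˡ (s i)) (s-cancel j w))))
      (≡.trans (ascent-len i-ascent) (≡.cong suc (descent-len j-descent)))
    combination : U 2 * act (v ⁻¹) (α j) l + U 1 * act (v ⁻¹) (α i) l ≈ act (w ⁻¹) (α i) l
    combination = trans
      (solve 3 (λ x y z → ((x :+ x) :* :1 :- :0) :* z :+ :1 :* y := y :+ (x :+ x) :* z) refl
        (cosπ/ (m j i)) (act (v ⁻¹) (α i) l) (act (v ⁻¹) (α j) l))
      (trans (+-congˡ (*-congʳ (reflexive (≡.cong (λ k → cosπ/ k + cosπ/ k) (symmetric j i)))))
             (sym (act-⁻¹-simple-other i≢j w l)))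

  ascent-NonNegative : ∀ {w i} → len w ℕ.< len (s i ∙ w) → NonNegative (act (w ⁻¹) (α i))
  ascent-NonNegative = positiveUpTo _ _ _ ℕₚ.≤-refl

-- Signs of roots, parabolic spans and inversion sets.

module Signs {n : ℕ} {c ℓ a ℓ₁ ℓ₂ : Level}
             (C : FiniteCoxeterSystem n c ℓ) (K : OrderedField a ℓ₁ ℓ₂)
             (cosπ/ : ℕ → OrderedField.Carrier K)
             (isCosπ/ : ∀ {i j} → i ≢ j →
                Cosine.IsCosπ/ K (FiniteCoxeterSystem.m C i j) (cosπ/ (FiniteCoxeterSystem.m C i j)))
             where
  private module G = FiniteCoxeterSystem C
  open FiniteCoxeterSystem C using (m; s; ε) renaming (Carrier to W; _∙_ to infixl 7 _∙_; _⁻¹ to infix 8 _⁻¹; _≈_ to infix 4 _≈ᵂ_)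
  open CoxeterGroup C
  open RootSystem C K cosπ/
  open OrderedField K hiding (zero) renaming (_<_ to infix 4 _<_)
  open FieldProperties K
  open Representation C K cosπ/ isCosπ/
  open Positivity C K cosπ/ isCosπ/
  open Length C
  open import Algebra.Properties.Semiring.Sum semiring using (sum)

  -- A root x α_i is represented by x and i; its negative is then given by x s_i and i.
  record Pos (x : W) (i : Fin n) : Set ℓ₂ where
    constructor mkPos
    field ≥0 : NonNegative (act x (α i))

  record Neg (x : W) (i : Fin n) : Set ℓ₂ where
    constructor mkNeg
    field ≤0 : NonNegative (λ k → - act x (α i) k)

  open Pos
  open Neg

  act-∙-s : ∀ x i → act (x ∙ s i) (α i) ≋ (λ k → - act x (α i) k)
  act-∙-s x i k = trans (act-∙ x (s i) (α i) k)
    (trans (act-congʳ x (λ l → trans (act-s i (α i) l) (reflection-simple i l)) k) (act-neg x (α i) k))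

  Pos-cong : ∀ {x y i} → x ≈ᵂ y → Pos x i → Pos y i
  Pos-cong {i = i} x≈y pos = mkPos λ k → NonNeg-resp (act-congˡ x≈y (α i) k) (≥0 pos k)

  Neg-cong : ∀ {x y i} → x ≈ᵂ y → Neg x i → Neg y i
  Neg-cong {i = i} x≈y neg = mkNeg λ k → NonNeg-resp (-‿cong (act-congˡ x≈y (α i) k)) (≤0 neg k)

  Pos⇒Neg-s : ∀ {x i} → Pos x i → Neg (x ∙ s i) i
  Pos⇒Neg-s {x} {i} pos = mkNeg λ k → NonNeg-resp (trans (sym (-‿involutive _)) (-‿cong (sym (act-∙-s x i k)))) (≥0 pos k)

  Neg⇒Pos-s : ∀ {x i} → Neg x i → Pos (x ∙ s i) i
  Neg⇒Pos-s {x} {i} neg = mkPos λ k → NonNeg-resp (sym (act-∙-s x i k)) (≤0 neg k)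

  ∙-s-s : ∀ x i → (x ∙ s i) ∙ s i ≈ᵂ x
  ∙-s-s x i = G.trans (G.assoc x (s i) (s i)) (G.trans (G.∙-congˡ (s-involutive i)) (G.identityʳ x))

  Pos-s⇒Neg : ∀ {x i} → Pos (x ∙ s i) i → Neg x i
  Pos-s⇒Neg pos = Neg-cong (∙-s-s _ _) (Pos⇒Neg-s pos)

  Neg-s⇒Pos : ∀ {x i} → Neg (x ∙ s i) i → Pos x i
  Neg-s⇒Pos neg = Pos-cong (∙-s-s _ _) (Neg⇒Pos-s neg)

  Pos-ε : ∀ i → Pos ε i
  Pos-ε i = mkPos λ k → NonNeg-resp (sym (act-ε (α i) k)) (α-NonNegative i k)

  -- A root of both signs would be zero, and applying x⁻¹ would make α_i zero, whereas its i-th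
  -- coordinate is 1.
  ¬Pos×Neg : ∀ {x i} → Pos x i → ¬ Neg x i
  ¬Pos×Neg {x} {i} pos neg = <-irrefl (sym 1≈0) 0<1
    where
    1≈0 : 1# ≈ 0#
    1≈0 = trans (sym (trans (act-congˡ (G.inverseˡ x) (α i) i) (trans (act-ε (α i) i) (δ-same i))))
      (trans (act-∙ (x ⁻¹) x (α i) i)
      (trans (act-congʳ (x ⁻¹) (λ k → NonNeg-antisym (≥0 pos k) (≤0 neg k)) i)
             (IsLinear.zero-homo (act-linear (x ⁻¹) i))))

  ascent⇒Pos : ∀ {w i} → len w ℕ.< len (s i ∙ w) → Pos (w ⁻¹) i
  ascent⇒Pos asc = mkPos (ascent-NonNegative asc)

  descent⇒Neg : ∀ {w i} → len (s i ∙ w) ℕ.< len w → Neg (w ⁻¹) i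
  descent⇒Neg {w} {i} des = mkNeg λ k → NonNeg-resp
    (trans (sym (-‿involutive _)) (-‿cong (sym (act-⁻¹-simple-same i w k))))
    (ascent-NonNegative (≡.subst (len (s i ∙ w) ℕ.<_) (len-cong (G.sym (s-cancel i w))) des) k)

  -- Every root is positive or negative. The comparison of two lengths decides which, so the case
  -- splits and refutations below are constructive.
  Pos⊎Neg : ∀ x i → Pos x i ⊎ Neg x i
  Pos⊎Neg x i with ascent⊎descent i (x ⁻¹)
  ... | inj₁ asc = inj₁ (Pos-cong (⁻¹-involutive x) (ascent⇒Pos asc))
  ... | inj₂ des = inj₂ (Neg-cong (⁻¹-involutive x) (descent⇒Neg des))

  ¬Pos⇒Neg : ∀ {x i} → ¬ Pos x i → Neg x i
  ¬Pos⇒Neg {x} {i} ¬pos with Pos⊎Neg x i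
  ... | inj₁ pos = ⊥-elim (¬pos pos)
  ... | inj₂ neg = neg

  ¬Neg⇒Pos : ∀ {x i} → ¬ Neg x i → Pos x i
  ¬Neg⇒Pos {x} {i} ¬neg with Pos⊎Neg x i
  ... | inj₁ pos = pos
  ... | inj₂ neg = ⊥-elim (¬neg neg)

  Pos⇒ascent : ∀ {w i} → Pos (w ⁻¹) i → len w ℕ.< len (s i ∙ w)
  Pos⇒ascent {w} {i} pos with ascent⊎descent i w
  ... | inj₁ asc = asc
  ... | inj₂ des = ⊥-elim (¬Pos×Neg pos (descent⇒Neg des))

  module _ {I : Pred (Fin n) 0ℓ} where

    -- A reflection s_i with i ∈ I subtracts a multiple of α_i, so no coordinate outside I changes.
    -- For an inverse, apply the claim for x to x⁻¹ v.
    act-outside : ∀ {x} → x ∈ ⟨ I ⟩ → ∀ v {j} → ¬ (j ∈ I) → act x v j ≈ v j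
    act-outside (gen {i} i∈I) v {j} j∉I = trans (act-s i v j)
      (trans (+-congˡ (-‿cong (trans (*-congˡ (δ-other {i} {j} λ { ≡.refl → j∉I i∈I })) (zeroʳ _))))
             (trans (+-congˡ -0#≈0#) (+-identityʳ _)))
    act-outside unit v j∉I = act-ε v _
    act-outside (mul {x} {y} x∈ y∈) v j∉I =
      trans (act-∙ x y v _) (trans (act-outside x∈ (act y v) j∉I) (act-outside y∈ v j∉I))
    act-outside (inv {x} x∈) v j∉I = trans (sym (act-outside x∈ (act (x ⁻¹) v) j∉I))
      (trans (sym (act-∙ x (x ⁻¹) v _)) (trans (act-congˡ (G.inverseʳ x) v _) (act-ε v _)))
    act-outside (resp x≈y x∈) v j∉I = trans (act-congˡ (G.sym x≈y) v _) (act-outside x∈ v j∉I)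

    act-NonNegative : ∀ {f v} → IsLinear f → (∀ {j} → ¬ (j ∈ I) → v j ≈ 0#) → NonNegative v →
                      (∀ {j} → j ∈ I → NonNeg (f (α j))) → NonNeg (f v)
    act-NonNegative {f} {v} lin v≈0 v≥0 f≥0 = NonNeg-resp (sym (linear-expansion lin v)) (sum-NonNeg terms)
      where
      sum-NonNeg : ∀ {p} {t : Fin p → Carrier} → (∀ j → NonNeg (t j)) → NonNeg (sum t)
      sum-NonNeg {zero}  t≥0 = NonNeg-0 refl
      sum-NonNeg {suc p} t≥0 = NonNeg-+ (t≥0 zero) (sum-NonNeg (t≥0 ∘ suc))
      -- I need not be decidable, but a negative term refutes both j ∈ I and j ∉ I.
      terms : ∀ j → NonNeg (v j * f (α j))
      terms j term<0 = NonNeg-0 (trans (*-congʳ (v≈0 j∉I)) (zeroˡ _)) term<0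
        where
        j∉I : ¬ (j ∈ I)
        j∉I j∈I = NonNeg-* (v≥0 j) (f≥0 j∈I) term<0

  -- The root y α_i belongs to the subsystem of W_I: it lies in the span of the α_j with j ∈ I.
  record Supp (I : Pred (Fin n) 0ℓ) (y : W) (i : Fin n) : Set ℓ₁ where
    constructor mkSupp
    field vanishes : ∀ {j} → ¬ (j ∈ I) → act y (α i) j ≈ 0#

  open Supp

  module _ {I : Pred (Fin n) 0ℓ} where

    Supp-cong : ∀ {x y i} → x ≈ᵂ y → Supp I x i → Supp I y i
    Supp-cong {i = i} x≈y supp = mkSupp λ j∉I → trans (act-congˡ (G.sym x≈y) (α i) _) (vanishes supp j∉I)

    Supp-ε : ∀ {i} → i ∈ I → Supp I ε i
    Supp-ε {i} i∈I = mkSupp λ {j} j∉I → trans (act-ε (α i) j) (δ-other {i} {j} λ { ≡.refl → j∉I i∈I })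

    Supp-∙ : ∀ {x y i} → x ∈ ⟨ I ⟩ → Supp I y i → Supp I (x ∙ y) i
    Supp-∙ {x} {y} {i} x∈ supp = mkSupp λ j∉I → trans (act-∙ x y (α i) _) (trans (act-outside x∈ (act y (α i)) j∉I) (vanishes supp j∉I))

    Supp-s : ∀ {y i} → Supp I y i → Supp I (y ∙ s i) i
    Supp-s {y} {i} supp = mkSupp λ {j} j∉I → trans (act-∙-s y i j) (trans (-‿cong (vanishes supp j∉I)) -0#≈0#)

    -- Coordinates outside I survive x unchanged, so there they are both nonnegative and
    -- nonpositive.
    inversion⇒Supp : ∀ {x y i} → x ∈ ⟨ I ⟩ → Pos y i → Neg (x ∙ y) i → Supp I y i
    inversion⇒Supp {x} {y} {i} x∈ pos neg = mkSupp λ {j} j∉I → NonNeg-antisym (≥0 pos j)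
      (NonNeg-resp (-‿cong (trans (act-∙ x y (α i) j) (act-outside x∈ (act y (α i)) j∉I))) (≤0 neg j))

    Pos-∙ : ∀ {w y i} → Supp I y i → (∀ {j} → j ∈ I → Pos w j) → Pos y i → Pos (w ∙ y) i
    Pos-∙ {w} {y} {i} supp w-pos pos = mkPos λ k → NonNeg-resp (sym (act-∙ w y (α i) k))
      (act-NonNegative (act-linear w k) (vanishes supp) (≥0 pos) (λ j∈I → ≥0 (w-pos j∈I) k))

    Pos-∙-Neg : ∀ {w y i} → Supp I y i → (∀ {j} → j ∈ I → Pos w j) → Neg y i → Neg (w ∙ y) i
    Pos-∙-Neg {w} {y} {i} supp w-pos neg =
      Pos-s⇒Neg (Pos-cong (G.sym (G.assoc w y (s i))) (Pos-∙ (Supp-s supp) w-pos (Neg⇒Pos-s neg)))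

    Neg-∙ : ∀ {w y i} → Supp I y i → (∀ {j} → j ∈ I → Neg w j) → Pos y i → Neg (w ∙ y) i
    Neg-∙ {w} {y} {i} supp w-neg pos = mkNeg λ k → NonNeg-resp (-‿cong (sym (act-∙ w y (α i) k)))
      (act-NonNegative (negated k) (vanishes supp) (≥0 pos) (λ j∈I → ≤0 (w-neg j∈I) k))
      where
      negated : ∀ k → IsLinear (λ v → - act w v k)
      negated k = record
        { cong  = λ u≋v → -‿cong (cong u≋v)
        ; add   = λ u v → trans (-‿cong (add u v)) (sym (-‿+-comm _ _))
        ; scale = λ t v → trans (-‿cong (scale t v)) (-‿distribʳ-* t _)
        }
        where open IsLinear (act-linear w k)

  infix 4 _≼_
  -- Inclusion of inversion sets without vectors: a positive root β = y α_i is in Φ_u exactly when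
  -- u⁻¹ β is negative.
  record _≼_ (u w : W) : Set (c ⊔ ℓ₂) where
    constructor mk≼
    field inversion : ∀ {y i} → Pos y i → Neg (u ⁻¹ ∙ y) i → Neg (w ⁻¹ ∙ y) i

  open _≼_ public

  ≤⇒≼ : ∀ {u w} → u ≤ w → u ≼ w
  ≤⇒≼ {u} {w} u≤w = mk≼ λ {y} {i} pos neg → negative (u≤w
    ( ((y , i , λ _ → refl) , ≥0 pos)
    , act (u ⁻¹ ∙ y) (α i)
    , ((u ⁻¹ ∙ y ∙ s i , i , λ k → sym (act-∙-s (u ⁻¹ ∙ y) i k)) , ≤0 neg)
    , λ k → trans (act-congˡ (G.sym (cancelʳ u y)) (α i) k) (act-∙ u (u ⁻¹ ∙ y) (α i) k)))
    where
    negative : ∀ {y i} → act y (α i) ∈ Φ[ w ] → Neg (w ⁻¹ ∙ y) i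
    negative {y} {i} (_ , γ , (_ , γ-neg) , β≋wγ) = mkNeg λ k → NonNeg-resp (-‿cong (sym (w⁻¹β≋γ k))) (γ-neg k)
      where
      w⁻¹β≋γ : act (w ⁻¹ ∙ y) (α i) ≋ γ
      w⁻¹β≋γ k = trans (act-∙ (w ⁻¹) y (α i) k) (trans (act-congʳ (w ⁻¹) β≋wγ k)
        (trans (sym (act-∙ (w ⁻¹) w γ k)) (trans (act-congˡ (G.inverseˡ w) γ k) (act-ε γ k))))

  ≼⇒≤ : ∀ {u w} → u ≼ w → u ≤ w
  ≼⇒≤ {u} {w} u≼w {β} (((y , i , β≋) , β-pos) , γ , (_ , γ-neg) , β≋uγ) =
    ((y , i , β≋) , β-pos) , act (w ⁻¹ ∙ y) (α i) ,
    ((w ⁻¹ ∙ y ∙ s i , i , λ k → sym (act-∙-s (w ⁻¹ ∙ y) i k)) ,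
      ≤0 {i = i} (inversion u≼w (mkPos λ k → NonNeg-resp (β≋ k) (β-pos k)) (mkNeg λ k → NonNeg-resp (-‿cong (sym (u⁻¹β≋γ k))) (γ-neg k)))) ,
    λ k → trans (β≋ k) (trans (act-congˡ (G.sym (cancelʳ w y)) (α i) k) (act-∙ w (w ⁻¹ ∙ y) (α i) k))
    where
    u⁻¹β≋γ : act (u ⁻¹ ∙ y) (α i) ≋ γ
    u⁻¹β≋γ k = trans (act-∙ (u ⁻¹) y (α i) k) (trans (act-congʳ (u ⁻¹) (λ l → trans (sym (β≋ l)) (β≋uγ l)) k)
      (trans (sym (act-∙ (u ⁻¹) u γ k)) (trans (act-congˡ (G.inverseˡ u) γ k) (act-ε γ k))))

-- Weak order, parabolic projections and joins.

module WeakOrder {n : ℕ} {c ℓ a ℓ₁ ℓ₂ : Level}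
                 (C : FiniteCoxeterSystem n c ℓ) (K : OrderedField a ℓ₁ ℓ₂)
                 (cosπ/ : ℕ → OrderedField.Carrier K)
                 (isCosπ/ : ∀ {i j} → i ≢ j →
                    Cosine.IsCosπ/ K (FiniteCoxeterSystem.m C i j) (cosπ/ (FiniteCoxeterSystem.m C i j)))
                 where
  open FiniteCoxeterSystem C renaming (_∙_ to infixl 7 _∙_; _⁻¹ to infix 8 _⁻¹; _≈_ to infix 4 _≈_)
  open CoxeterGroup C
  open Length C
  open Signs C K cosπ/ isCosπ/
  open import Relation.Binary.Reasoning.Setoid setoid

  ∙-⁻¹-∙ : ∀ x y z → (x ∙ y) ⁻¹ ∙ z ≈ y ⁻¹ ∙ (x ⁻¹ ∙ z)
  ∙-⁻¹-∙ x y z = trans (∙-congʳ (⁻¹-anti-homo-∙ x y)) (assoc (y ⁻¹) (x ⁻¹) z)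

  cancel-prefix : ∀ z x y → (z ∙ x) ⁻¹ ∙ (z ∙ y) ≈ x ⁻¹ ∙ y
  cancel-prefix z x y = trans (∙-⁻¹-∙ z x (z ∙ y)) (∙-congˡ (cancelˡ z y))

  ≼-refl : ∀ {u} → u ≼ u
  ≼-refl = mk≼ λ _ neg → neg

  ≼-trans : ∀ {u v w} → u ≼ v → v ≼ w → u ≼ w
  ≼-trans u≼v v≼w = mk≼ λ pos neg → inversion v≼w pos (inversion u≼v pos neg)

  ≼-reflexive : ∀ {u w} → u ≈ w → u ≼ w
  ≼-reflexive u≈w = mk≼ λ _ neg → Neg-cong (∙-congʳ (⁻¹-cong u≈w)) neg

  ε-≼ : ∀ {w} → ε ≼ w
  ε-≼ = mk≼ λ pos neg → ⊥-elim (¬Pos×Neg pos (Neg-cong (trans (∙-congʳ ε⁻¹≈ε) (identityˡ _)) neg))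

  -- Split the inversions β of z x by the sign of z⁻¹ β: if negative, β is an inversion of z; if
  -- positive, z⁻¹ β is an inversion of x.
  ≼-translate : ∀ {z w x} → z ≼ w → x ≼ z ⁻¹ ∙ w → z ∙ x ≼ w
  ≼-translate {z} {w} {x} z≼w x≼z⁻¹w = mk≼ λ {y} {i} pos neg →
    [ (λ pos′ → Neg-cong (cancel-prefix (z ⁻¹) w y) (inversion x≼z⁻¹w pos′ (Neg-cong (∙-⁻¹-∙ z x y) neg)))
    , inversion z≼w pos
    ]′ (Pos⊎Neg (z ⁻¹ ∙ y) i)

  -- For an inversion β of x, the root z β is positive and so an inversion of z x. Otherwise - z β
  -- would be an inversion of z, hence of z x, making - x⁻¹ β negative.
  ≼-untranslate : ∀ {z w x} → z ≼ z ∙ x → z ∙ x ≼ w → x ≼ z ⁻¹ ∙ w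
  ≼-untranslate {z} {w} {x} z≼zx zx≼w = mk≼ λ {y} {i} pos neg →
    [ (λ pos′ → Neg-cong (trans (∙-congˡ (∙-congʳ (sym (⁻¹-involutive z)))) (sym (∙-⁻¹-∙ (z ⁻¹) w y)))
        (inversion zx≼w pos′ (Neg-cong (sym (cancel-prefix z x y)) neg)))
    , (λ neg′ → ⊥-elim (¬Pos×Neg
        (Neg-s⇒Pos (Neg-cong (trans (cancel-prefix z x (y ∙ s i)) (sym (assoc _ _ _)))
          (inversion z≼zx (Pos-cong (assoc z y (s i)) (Neg⇒Pos-s neg′))
            (Neg-cong (sym (cancelˡ z (y ∙ s i))) (Pos⇒Neg-s pos)))))
        neg))
    ]′ (Pos⊎Neg (z ∙ y) i)

  module _ {I : Pred (Fin n) 0ℓ} where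

    -- Inversions of x lie in the span of I, and there v⁻¹ turns positive roots negative because it
    -- does so to the simple ones.
    ≼-of-descents : ∀ {v x} → (∀ {i} → i ∈ I → Neg (v ⁻¹) i) → x ∈ ⟨ I ⟩ → x ≼ v
    ≼-of-descents descents x∈ = mk≼ λ pos neg → Neg-∙ (inversion⇒Supp (inv x∈) pos neg) descents pos

    -- Suppose β is an inversion of z but not of z x. Then γ = - z⁻¹ β is positive and x⁻¹ γ
    -- negative, so γ lies in the span of I, where z keeps signs; but z γ = - β.
    ≼-of-ascents : ∀ {z x} → (∀ {i} → i ∈ I → Pos z i) → x ∈ ⟨ I ⟩ → z ≼ z ∙ x
    ≼-of-ascents {z} {x} ascents x∈ = mk≼ λ {y} {i} pos neg → ¬Pos⇒Neg λ pos′ →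
      let γ-pos = Neg⇒Pos-s neg
          γ-neg = Neg-cong (assoc _ _ _) (Pos⇒Neg-s (Pos-cong (∙-⁻¹-∙ z x y) pos′))
          zγ-pos = Pos-∙ (inversion⇒Supp (inv x∈) γ-pos γ-neg) ascents γ-pos
      in ¬Pos×Neg pos (Pos-s⇒Neg (Pos-cong (trans (∙-congˡ (assoc _ _ _)) (cancelʳ z (y ∙ s i))) zγ-pos))

  Neg⇒s-≼ : ∀ {v i} → Neg (v ⁻¹) i → s i ≼ v
  Neg⇒s-≼ {v} {i} neg = ≼-of-descents {I = _≡ i} (λ { ≡.refl → neg }) (gen ≡.refl)

  s-≼⇒Neg : ∀ {v i} → s i ≼ v → Neg (v ⁻¹) i
  s-≼⇒Neg {v} {i} s≼v = Neg-cong (identityʳ _) (inversion s≼v (Pos-ε i)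
    (Neg-cong (trans (identityˡ (s i)) (trans (sym (s⁻¹≈s i)) (sym (identityʳ _)))) (Pos⇒Neg-s (Pos-ε i))))

  -- The first letter s_i of a shortest word for u⁻¹ w gives the cover. Were u α_i negative, - u α_i
  -- would be an inversion of u and hence of w, so s_i would be no descent of u⁻¹ w.
  ≼-cover : ∀ {u w} → u ≼ w → u ≈ w ⊎ ∃ λ i → Pos u i × u ∙ s i ≼ w
  ≼-cover {u} {w} u≼w with exists-descent (u ⁻¹ ∙ w)
  ... | inj₁ u⁻¹w≈ε    = inj₁ (trans (sym (identityʳ u)) (trans (∙-congˡ (sym u⁻¹w≈ε)) (cancelʳ u w)))
  ... | inj₂ (i , des) = inj₂ (i , ¬Neg⇒Pos ¬neg , ≼-translate u≼w (Neg⇒s-≼ v⁻¹-neg))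
    where
    v⁻¹-neg : Neg ((u ⁻¹ ∙ w) ⁻¹) i
    v⁻¹-neg = descent⇒Neg des
    ¬neg : ¬ Neg u i
    ¬neg neg = ¬Pos×Neg
      (Neg-s⇒Pos (Neg-cong (begin
        w ⁻¹ ∙ (u ∙ s i)             ≈⟨ ∙-congˡ (∙-congʳ (⁻¹-involutive u)) ⟨
        w ⁻¹ ∙ (u ⁻¹ ⁻¹ ∙ s i)       ≈⟨ ∙-⁻¹-∙ (u ⁻¹) w (s i) ⟨
        (u ⁻¹ ∙ w) ⁻¹ ∙ s i          ∎)
        (inversion u≼w (Neg⇒Pos-s neg) (Neg-cong (trans (identityˡ (s i)) (sym (cancelˡ u (s i)))) (Pos⇒Neg-s (Pos-ε i))))))
      v⁻¹-neg

  w₀ : Carrier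
  w₀ = proj₁ longest

  w₀⁻¹-Neg : ∀ i → Neg (w₀ ⁻¹) i
  w₀⁻¹-Neg i = [ (λ asc → ⊥-elim (ℕₚ.<⇒≱ asc (proj₂ longest (s i ∙ w₀)))) , descent⇒Neg ]′ (ascent⊎descent i w₀)

  w₀⁻¹-∙-Neg : ∀ {y i} → Pos y i → Neg (w₀ ⁻¹ ∙ y) i
  w₀⁻¹-∙-Neg = Neg-∙ {I = Unary.U} (mkSupp λ ∉U → ⊥-elim (∉U tt)) (λ {i} _ → w₀⁻¹-Neg i)

  ∈⟨U⟩ : ∀ w → w ∈ ⟨ Unary.U ⟩
  ∈⟨U⟩ w = resp (proj₂ (generated w)) (eval-∈ (proj₁ (generated w)))
    where
    eval-∈ : ∀ v → eval v ∈ ⟨ Unary.U ⟩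
    eval-∈ []      = unit
    eval-∈ (i ∷ v) = mul (gen tt) (eval-∈ v)

  ⟨⟩-mono : ∀ {I J : Pred (Fin n) 0ℓ} → I ⊆ J → ⟨ I ⟩ ⊆ ⟨ J ⟩
  ⟨⟩-mono I⊆J (gen i∈)      = gen (I⊆J i∈)
  ⟨⟩-mono I⊆J unit          = unit
  ⟨⟩-mono I⊆J (mul x∈ y∈)   = mul (⟨⟩-mono I⊆J x∈) (⟨⟩-mono I⊆J y∈)
  ⟨⟩-mono I⊆J (inv x∈)      = inv (⟨⟩-mono I⊆J x∈)
  ⟨⟩-mono I⊆J (resp x≈y x∈) = resp x≈y (⟨⟩-mono I⊆J x∈)

  module _ {I : Pred (Fin n) 0ℓ} where

    -- Left descents in I are stripped until none remains; each shortens w, so `len w` is enough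
    -- fuel.
    projection : Unary.Decidable I → ∀ w → ∃ (IsProjection I w)
    projection I? w = search (len w) w ℕₚ.≤-refl
      where
      search : ∀ N w → len w ℕ.≤ N → ∃ (IsProjection I w)
      search N w w≤N with any? (λ i → I? i ×-dec (len (s i ∙ w) ℕₚ.<? len w))
      ... | no none = ε , unit , w , (∈⟨U⟩ w , ascents) , sym (identityˡ w)
        where
        ascents : ∀ i → i ∈ I → len w ℕ.< len (s i ∙ w)
        ascents i i∈I = [ (λ asc → asc) , (λ des → ⊥-elim (none (i , i∈I , des))) ]′ (ascent⊎descent i w)
      ... | yes (i , i∈I , des) with N
      ...   | zero  = ⊥-elim (ℕₚ.n≮0 (ℕₚ.<-≤-trans des w≤N))
      ...   | suc N with search N (s i ∙ w) (ℕₚ.≤-pred (ℕₚ.<-≤-trans des w≤N))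
      ...     | p , p∈ , x , x∈ , sw≈px = s i ∙ p , mul (gen i∈I) p∈ , x , x∈ ,
                  trans (sym (s-cancel i w)) (trans (∙-congˡ sw≈px) (sym (assoc _ _ _)))

    IsProjection-cong : ∀ {w p q} → p ≈ q → IsProjection I w p → IsProjection I w q
    IsProjection-cong p≈q (p∈ , x , x∈ , w≈px) = resp p≈q p∈ , x , x∈ , trans w≈px (∙-congʳ p≈q)

    module _ {v p y i} (proj : IsProjection I v p) (supp : Supp I y i) where
      private
        x = proj₁ (proj₂ proj)

        x⁻¹-Pos : ∀ {j} → j ∈ I → Pos (x ⁻¹) j
        x⁻¹-Pos j∈I = ascent⇒Pos (proj₂ (proj₁ (proj₂ (proj₂ proj))) _ j∈I)

        p⁻¹y-Supp : Supp I (p ⁻¹ ∙ y) i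
        p⁻¹y-Supp = Supp-∙ (inv (proj₁ proj)) supp

        factor : x ⁻¹ ∙ (p ⁻¹ ∙ y) ≈ v ⁻¹ ∙ y
        factor = trans (sym (∙-⁻¹-∙ p x y)) (∙-congʳ (⁻¹-cong (sym (proj₂ (proj₂ (proj₂ proj))))))

      -- Here v⁻¹ = x⁻¹ p⁻¹, and x⁻¹ keeps signs on the span of I since x has no descents in I. With
      -- `projection-Neg` this gives Φ_p = Φ_v ∩ span(I).
      projection-Pos : Pos (p ⁻¹ ∙ y) i → Pos (v ⁻¹ ∙ y) i
      projection-Pos pos = Pos-cong factor (Pos-∙ p⁻¹y-Supp x⁻¹-Pos pos)

      projection-Neg : Neg (p ⁻¹ ∙ y) i → Neg (v ⁻¹ ∙ y) i
      projection-Neg neg = Neg-cong factor (Pos-∙-Neg p⁻¹y-Supp x⁻¹-Pos neg)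

  Supp-mono : ∀ {I J : Pred (Fin n) 0ℓ} {y i} → I ⊆ J → Supp I y i → Supp J y i
  Supp-mono I⊆J supp = mkSupp λ j∉J → Supp.vanishes supp (j∉J ∘ I⊆J)

  -- Allowing I ⊆ J covers two uses: monotonicity of one projection, and comparison of nested
  -- projections of the same element.
  projection-mono : ∀ {I J : Pred (Fin n) 0ℓ} {u v p q} → I ⊆ J →
    IsProjection I u p → IsProjection J v q → u ≼ v → p ≼ q
  projection-mono {I} I⊆J p-proj q-proj u≼v = mk≼ λ pos neg →
    let supp = inversion⇒Supp (inv (proj₁ p-proj)) pos neg
    in ¬Pos⇒Neg λ pos′ →
      ¬Pos×Neg (projection-Pos q-proj (Supp-mono I⊆J supp) pos′) (inversion u≼v pos (projection-Neg p-proj supp neg))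

  IsJoin : Carrier → Carrier → Carrier → Set _
  IsJoin x y t = x ≼ t × y ≼ t × (∀ {r} → x ≼ r → y ≼ r → t ≼ r)

  -- The projection d of w₀ is the longest element of the parabolic subgroup
  -- generated by s_i and s_j.
  cover-join : ∀ {z i j} → Pos z i → Pos z j → ∃ (IsJoin (z ∙ s i) (z ∙ s j))
  cover-join {z} {i} {j} zi-pos zj-pos =
    z ∙ d , above (inj₁ ≡.refl) , above (inj₂ ≡.refl) , least-above
    where
    I : Pred (Fin n) 0ℓ
    I k = k ≡ i ⊎ k ≡ j
    proj = projection {I} (λ k → (k ≟ᶠ i) ⊎-dec (k ≟ᶠ j)) w₀
    d = proj₁ proj
    d∈ : d ∈ ⟨ I ⟩
    d∈ = proj₁ (proj₂ proj)
    d⁻¹-Neg : ∀ {k} → k ∈ I → Neg (d ⁻¹) k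
    d⁻¹-Neg k∈I = ¬Pos⇒Neg λ pos → ¬Pos×Neg
      (projection-Pos (proj₂ proj) (Supp-ε k∈I) (Pos-cong (sym (identityʳ _)) pos))
      (w₀⁻¹-∙-Neg (Pos-ε _))
    z-Pos : ∀ {k} → k ∈ I → Pos z k
    z-Pos (inj₁ ≡.refl) = zi-pos
    z-Pos (inj₂ ≡.refl) = zj-pos
    above : ∀ {k} → k ∈ I → z ∙ s k ≼ z ∙ d
    above k∈I = ≼-translate (≼-of-ascents z-Pos d∈)
      (Neg⇒s-≼ (Neg-cong (⁻¹-cong (sym (cancelˡ z d))) (d⁻¹-Neg k∈I)))
    least-above : ∀ {r} → z ∙ s i ≼ r → z ∙ s j ≼ r → z ∙ d ≼ r
    least-above {r} zi≼r zj≼r = ≼-translate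
      (≼-trans (≼-of-ascents z-Pos (gen (inj₁ ≡.refl))) zi≼r)
      (≼-of-descents descents d∈)
      where
      descents : ∀ {k} → k ∈ I → Neg ((z ⁻¹ ∙ r) ⁻¹) k
      descents k∈I@(inj₁ ≡.refl) = s-≼⇒Neg (≼-untranslate (≼-of-ascents z-Pos (gen k∈I)) zi≼r)
      descents k∈I@(inj₂ ≡.refl) = s-≼⇒Neg (≼-untranslate (≼-of-ascents z-Pos (gen k∈I)) zj≼r)

  -- Björner–Edelman–Ziegler: joins of covers of a common element suffice,
  -- by downward induction on a common lower bound z.
  join-above : ∀ N {z x y} → len w₀ ℕ.≤ N ℕ.+ len (z ⁻¹) → z ≼ x → z ≼ y → ∃ (IsJoin x y)
  join-above N {z} {x} {y} bound z≼x z≼y with ≼-cover z≼x | ≼-cover z≼y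
  ... | inj₁ z≈x | _ = y , ≼-trans (≼-reflexive (sym z≈x)) z≼y , ≼-refl , λ _ y≼r → y≼r
  ... | inj₂ _ | inj₁ z≈y = x , ≼-refl , ≼-trans (≼-reflexive (sym z≈y)) z≼x , λ x≼r _ → x≼r
  ... | inj₂ (i , i-pos , zi≼x) | inj₂ (j , j-pos , zj≼y) = go N bound
    where
    -- Ascents concern left multiplication, whereas covers multiply z on the right; hence lengths of
    -- inverses.
    grows : ∀ {k} → Pos z k → len (z ⁻¹) ℕ.< len ((z ∙ s k) ⁻¹)
    grows {k} pos = ℕₚ.<-≤-trans (Pos⇒ascent (Pos-cong (sym (⁻¹-involutive z)) pos))
      (ℕₚ.≤-reflexive (len-cong (sym (trans (⁻¹-anti-homo-∙ z (s k)) (∙-congʳ (s⁻¹≈s k))))))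
    go : ∀ N → len w₀ ℕ.≤ N ℕ.+ len (z ⁻¹) → ∃ (IsJoin x y)
    go zero    bound = ⊥-elim (ℕₚ.<⇒≱ (ℕₚ.<-≤-trans (grows i-pos) (proj₂ longest _)) bound)
    go (suc N) bound =
      let next : ∀ {k} → Pos z k → len w₀ ℕ.≤ N ℕ.+ len ((z ∙ s k) ⁻¹)
          next pos = ℕₚ.≤-trans bound (ℕₚ.≤-trans (ℕₚ.≤-reflexive (≡.sym (ℕₚ.+-suc N _))) (ℕₚ.+-monoʳ-≤ N (grows pos)))
          -- With t = z s_i ∨ z s_j, take e = x ∨ t above z s_i and then f = e ∨ y above z s_j.
          -- Every upper bound of x and y lies above both covers, hence above t, e and f in turn.
          t , zi≼t , zj≼t , t-least = cover-join i-pos j-pos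
          e , x≼e , t≼e , e-least = join-above N (next i-pos) zi≼x zi≼t
          f , e≼f , y≼f , f-least = join-above N (next j-pos) (≼-trans zj≼t t≼e) zj≼y
      in f , ≼-trans x≼e e≼f , y≼f , λ x≼r y≼r →
           f-least (e-least x≼r (t-least (≼-trans zi≼x x≼r) (≼-trans zj≼y y≼r))) y≼r

  join : ∀ x y → ∃ (IsJoin x y)
  join x y = join-above (len w₀) (ℕₚ.m≤m+n (len w₀) _) ε-≼ ε-≼

  -- If w₀ = p d with p ∈ W_I and d a minimal coset representative, then the
  -- inversions of x d contain all positive roots outside the span of I, so
  -- projecting an upper bound x d of u and w gives back x.
  projection-join : ∀ {I : Pred (Fin n) 0ℓ} → Unary.Decidable I → ∀ {u w v p q r x} →
    IsProjection I u p → IsProjection I w q → IsProjection I v r → IsJoin u w v →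
    x ∈ ⟨ I ⟩ → p ≼ x → q ≼ x → r ≼ x
  projection-join {I} I? {x = x} p-proj q-proj r-proj (_ , _ , v-least) x∈ p≼x q≼x =
    projection-mono (λ i∈ → i∈) r-proj xd-proj (v-least (bound p-proj p≼x) (bound q-proj q≼x))
    where
    w₀-proj = proj₂ (projection I? w₀)
    p₀ = proj₁ (projection I? w₀)
    d = proj₁ (proj₂ w₀-proj)
    xd-proj : IsProjection I (x ∙ d) x
    xd-proj = x∈ , d , proj₁ (proj₂ (proj₂ w₀-proj)) , refl
    d⁻¹≈ : ∀ y → d ⁻¹ ∙ y ≈ w₀ ⁻¹ ∙ (p₀ ∙ y)
    d⁻¹≈ y = begin
      d ⁻¹ ∙ y                     ≈⟨ cancel-prefix p₀ d y ⟨
      (p₀ ∙ d) ⁻¹ ∙ (p₀ ∙ y)       ≈⟨ ∙-congʳ (⁻¹-cong (proj₂ (proj₂ (proj₂ w₀-proj)))) ⟨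
      w₀ ⁻¹ ∙ (p₀ ∙ y)             ∎
    bound : ∀ {u p} → IsProjection I u p → p ≼ x → u ≼ x ∙ d
    bound {u} {p} p-proj p≼x = mk≼ λ {y} {i} pos neg → ¬Pos⇒Neg λ pos′ →
      -- Let β be an inversion of u but not of x d. As d⁻¹ = w₀⁻¹ p₀ and w₀⁻¹ negates positive
      -- roots, p₀ x⁻¹ β is negative. Since p₀ x⁻¹ ∈ W_I, β lies in the span of I; so it is an
      -- inversion of p, then of x, then of x d, a contradiction.
      let flipped : Neg (p₀ ∙ x ⁻¹ ∙ y) i
          flipped = ¬Pos⇒Neg λ pos″ → ¬Pos×Neg pos′
            (Neg-cong (trans (∙-congˡ (assoc p₀ (x ⁻¹) y)) (trans (sym (d⁻¹≈ (x ⁻¹ ∙ y))) (sym (∙-⁻¹-∙ x d y))))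
                      (w₀⁻¹-∙-Neg pos″))
          supp = inversion⇒Supp (mul (proj₁ w₀-proj) (inv x∈)) pos flipped
          p⁻¹y-neg = ¬Pos⇒Neg λ pos″ → ¬Pos×Neg (projection-Pos p-proj supp pos″) neg
      in ¬Pos×Neg pos′ (projection-Neg xd-proj supp (inversion p≼x pos p⁻¹y-neg))

  module _ {I J : Pred (Fin n) 0ℓ} (I⊆J : I ⊆ J) {v j j′}
           (j-proj : IsProjection I v j) (j′-proj : IsProjection J v j′) where

    -- On the span of J, j′⁻¹ and v⁻¹ give equal signs. Hence a descent s_i with i ∈ I would make
    -- v⁻¹ j α_i = x⁻¹ α_i negative, against the minimality of x.
    projection-quotient : j ⁻¹ ∙ j′ ∈ MinRep I J
    projection-quotient = mul (inv (⟨⟩-mono I⊆J (proj₁ j-proj))) (proj₁ j′-proj) ,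
      λ i i∈I → Pos⇒ascent (¬Neg⇒Pos (¬neg i∈I))
      where
      x = proj₁ (proj₂ j-proj)
      ¬neg : ∀ {i} → i ∈ I → ¬ Neg ((j ⁻¹ ∙ j′) ⁻¹) i
      ¬neg {i} i∈I neg = ¬Pos×Neg (ascent⇒Pos (proj₂ (proj₁ (proj₂ (proj₂ j-proj))) i i∈I))
        (Neg-cong (begin
          v ⁻¹ ∙ j            ≈⟨ ∙-congʳ (⁻¹-cong (proj₂ (proj₂ (proj₂ j-proj)))) ⟩
          (j ∙ x) ⁻¹ ∙ j      ≈⟨ ∙-⁻¹-∙ j x j ⟩
          x ⁻¹ ∙ (j ⁻¹ ∙ j)   ≈⟨ ∙-congˡ (inverseˡ j) ⟩
          x ⁻¹ ∙ ε            ≈⟨ identityʳ _ ⟩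
          x ⁻¹                ∎)
          (projection-Neg j′-proj
            (Supp-cong (identityʳ j) (Supp-∙ (⟨⟩-mono I⊆J (proj₁ j-proj)) (Supp-ε (I⊆J i∈I))))
            (Neg-cong (begin
              (j ⁻¹ ∙ j′) ⁻¹          ≈⟨ identityʳ _ ⟨
              (j ⁻¹ ∙ j′) ⁻¹ ∙ ε      ≈⟨ ∙-⁻¹-∙ (j ⁻¹) j′ ε ⟩
              j′ ⁻¹ ∙ (j ⁻¹ ⁻¹ ∙ ε)   ≈⟨ ∙-congˡ (trans (identityʳ _) (⁻¹-involutive j)) ⟩
              j′ ⁻¹ ∙ j               ∎) neg)))

    -- The nested projections satisfy j ≼ j′, which is what permits cancelling the prefix j.
    projection-quotient-least : ∀ {z} → j′ ≼ j ∙ z → j ⁻¹ ∙ j′ ≼ z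
    projection-quotient-least {z} j′≼jz = ≼-trans
      (≼-untranslate
        (≼-trans (projection-mono I⊆J j-proj j′-proj ≼-refl) (≼-reflexive (sym (cancelʳ j j′))))
        (≼-trans (≼-reflexive (cancelʳ j j′)) j′≼jz))
      (≼-reflexive (cancelˡ j z))

  projection-all : ∀ {I : Pred (Fin n) 0ℓ} {v p} → (∀ i → i ∈ I) → IsProjection I v p → p ≈ v
  projection-all all (_ , x , (_ , ascents) , v≈px) with exists-descent x
  ... | inj₁ x≈ε       = sym (trans v≈px (trans (∙-congˡ x≈ε) (identityʳ _)))
  ... | inj₂ (i , des) = ⊥-elim (ℕₚ.<-asym des (ascents i (all i)))

  ⟨∅⟩ : ∀ {I : Pred (Fin n) 0ℓ} {x} → (∀ i → ¬ (i ∈ I)) → x ∈ ⟨ I ⟩ → x ≈ ε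
  ⟨∅⟩ ∅ (gen {i} i∈)    = ⊥-elim (∅ i i∈)
  ⟨∅⟩ ∅ unit            = refl
  ⟨∅⟩ ∅ (mul x∈ y∈)     = trans (∙-cong (⟨∅⟩ ∅ x∈) (⟨∅⟩ ∅ y∈)) (identityˡ ε)
  ⟨∅⟩ ∅ (inv x∈)        = trans (⁻¹-cong (⟨∅⟩ ∅ x∈)) ε⁻¹≈ε
  ⟨∅⟩ ∅ (resp x≈y x∈)   = trans (sym x≈y) (⟨∅⟩ ∅ x∈)

-- The recursion computes the join.

module JoinRecursion {n : ℕ} {c ℓ a ℓ₁ ℓ₂ : Level}
                     (C : FiniteCoxeterSystem n c ℓ) (K : OrderedField a ℓ₁ ℓ₂)
                     (cosπ/ : ℕ → OrderedField.Carrier K)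
                     (isCosπ/ : ∀ {i j} → i ≢ j →
                        Cosine.IsCosπ/ K (FiniteCoxeterSystem.m C i j) (cosπ/ (FiniteCoxeterSystem.m C i j)))
                     where
  open FiniteCoxeterSystem C renaming (_∙_ to infixl 7 _∙_; _⁻¹ to infix 8 _⁻¹; _≈_ to infix 4 _≈_)
  open CoxeterGroup C
  open RootSystem C K cosπ/ using (_≤_)
  open Recursion C K cosπ/
  open Length C
  open Signs C K cosπ/ isCosπ/
  open WeakOrder C K cosπ/ isCosπ/

  infixl 6 _∨_
  _∨_ : Op₂ Carrier
  x ∨ y = proj₁ (join x y)

  ∨-supremum : Supremum _≤_ _∨_
  ∨-supremum x y = ≼⇒≤ x≼x∨y , ≼⇒≤ y≼x∨y , λ _ x≤z y≤z → ≼⇒≤ (∨-least (≤⇒≼ x≤z) (≤⇒≼ y≤z))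
    where
    x≼x∨y = proj₁ (proj₂ (join x y))
    y≼x∨y = proj₁ (proj₂ (proj₂ (join x y)))
    ∨-least = proj₂ (proj₂ (proj₂ (join x y)))

  Initial? : ∀ k → Unary.Decidable (Initial k)
  Initial? k i = toℕ i ℕₚ.<? toℕ k

  Initial-mono : ∀ k → Initial (inject₁ k) ⊆ Initial (suc k)
  Initial-mono k {i} i<k = ℕₚ.m<n⇒m<1+n (≡.subst (toℕ i ℕ.<_) (toℕ-inject₁ k) i<k)

  Initial-fromℕ : ∀ i → i ∈ Initial (fromℕ n)
  Initial-fromℕ i = ≡.subst (toℕ i ℕ.<_) (≡.sym (toℕ-fromℕ n)) (toℕ<n i)

  module _ {r : Level} {≺ : (k : Fin n) → Rel (Rep k) r} (extension : ∀ k → IsLinearExtension k (≺ k))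
           {u w : Carrier} {uₖ wₖ : Fin (suc n) → Carrier}
           (u-proj : ∀ k → IsProjection (Initial k) u (uₖ k))
           (w-proj : ∀ k → IsProjection (Initial k) w (wₖ k)) where

    Admissible : Carrier → (k : Fin n) → Rep k → Set _
    Admissible j k x = uₖ (suc k) ≤ (j ∙ proj₁ x) × wₖ (suc k) ≤ (j ∙ proj₁ x)

    module _ {k : Fin n} {j j′ : Carrier}
             (j-proj : IsProjection (Initial (inject₁ k)) (u ∨ w) j)
             (j′-proj : IsProjection (Initial (suc k)) (u ∨ w) j′) where

      -- The expected z of step k. Taking j and j′ as any projections of u ∨ w lets this serve both
      -- the run built from chosen projections and a run given in advance.
      quotient : Rep k
      quotient = j ⁻¹ ∙ j′ , projection-quotient (λ {i} → Initial-mono k {i}) j-proj j′-proj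

      quotient-admissible : Admissible j k quotient
      quotient-admissible = above (u-proj (suc k)) (proj₁ (proj₂ (join u w))) , above (w-proj (suc k)) (proj₁ (proj₂ (proj₂ (join u w))))
        where
        above : ∀ {v p} → IsProjection (Initial (suc k)) v p → v ≼ u ∨ w → p ≤ (j ∙ (j ⁻¹ ∙ j′))
        above p-proj v≼ = ≼⇒≤ (≼-trans (projection-mono (λ i∈ → i∈) p-proj j′-proj v≼) (≼-reflexive (sym (cancelʳ j j′))))

      -- For admissible z, the product j z lies in the larger parabolic subgroup and bounds both
      -- projections, so `projection-join` puts j′ below it.
      quotient-least : ∀ z → Admissible j k z → proj₁ quotient ≼ proj₁ z
      quotient-least (z , z∈ , _) (u≤jz , w≤jz) = projection-quotient-least (λ {i} → Initial-mono k {i}) j-proj j′-proj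
        (projection-join (Initial? (suc k)) (u-proj (suc k)) (w-proj (suc k)) j′-proj (proj₂ (join u w))
          (mul (⟨⟩-mono (λ {i} → Initial-mono k {i}) (proj₁ j-proj)) z∈) (≤⇒≼ u≤jz) (≤⇒≼ w≤jz))

      open IsLinearExtension (extension k)
      open IsStrictTotalOrder isStrictTotalOrder using (irrefl; asym)

      quotient-minimal : IsMinimal (≺ k) (Admissible j k) quotient
      quotient-minimal = quotient-admissible , λ z z-admissible z≺q → case z z-admissible z≺q (proj₁ quotient ≈? proj₁ z)
        where
        case : ∀ z → Admissible j k z → ≺ k z quotient → Dec (proj₁ quotient ≈ proj₁ z) → ⊥
        case z z-admissible z≺q (yes q≈z) = irrefl (sym q≈z) z≺q
        case z z-admissible z≺q (no q≉z)  = asym z≺q (extends quotient z (≼⇒≤ (quotient-least z z-admissible)) q≉z)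

      -- A minimal z other than the quotient would be strictly above it in weak order, and the
      -- linear extension would place the quotient first.
      minimal⇒quotient : ∀ z → IsMinimal (≺ k) (Admissible j k) z → proj₁ quotient ≈ proj₁ z
      minimal⇒quotient z (z-admissible , z-minimal) = case (proj₁ quotient ≈? proj₁ z)
        where
        case : Dec (proj₁ quotient ≈ proj₁ z) → proj₁ quotient ≈ proj₁ z
        case (yes q≈z) = q≈z
        case (no q≉z)  = ⊥-elim (z-minimal quotient quotient-admissible
                           (extends quotient z (≼⇒≤ (quotient-least z z-admissible)) q≉z))

    run-exists : ∃[ j ] ∃[ z ] IsRun ≺ uₖ wₖ j z
    run-exists = (λ k → proj₁ (proj k)) , (λ k → quotient (proj₂ (proj (inject₁ k))) (proj₂ (proj (suc k)))) , record
      { start   = ⟨∅⟩ (λ _ ()) (proj₁ (proj₂ (proj zero)))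
      ; step    = λ k → sym (cancelʳ _ _)
      ; minimal = λ k → quotient-minimal (proj₂ (proj (inject₁ k))) (proj₂ (proj (suc k)))
      }
      where
      proj : ∀ k → ∃ (IsProjection (Initial k) (u ∨ w))
      proj k = projection (Initial? k) (u ∨ w)

    run-projects : ∀ {j z} → IsRun ≺ uₖ wₖ j z → ∀ k → IsProjection (Initial k) (u ∨ w) (j k)
    run-projects {j} {z} run = <-weakInduction _ base next
      where
      open IsRun run
      base : IsProjection (Initial zero) (u ∨ w) (j zero)
      base = resp (sym start) unit , u ∨ w , (∈⟨U⟩ (u ∨ w) , λ _ ()) , sym (trans (∙-congʳ start) (identityˡ _))
      next : ∀ k → IsProjection (Initial (inject₁ k)) (u ∨ w) (j (inject₁ k)) →
        IsProjection (Initial (suc k)) (u ∨ w) (j (suc k))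
      next k j-proj = IsProjection-cong
        (trans (sym (cancelʳ (j (inject₁ k)) j′))
          (trans (∙-congˡ (minimal⇒quotient j-proj j′-proj (z k) (minimal k))) (sym (step k))))
        j′-proj
        where
        j′ = proj₁ (projection (Initial? (suc k)) (u ∨ w))
        j′-proj = proj₂ (projection (Initial? (suc k)) (u ∨ w))

mainTheorem5 :
    {c ℓ a ℓ₁ ℓ₂ r : Level} (n : ℕ)
    (C : FiniteCoxeterSystem n c ℓ) (K : OrderedField a ℓ₁ ℓ₂)
    (cosπ/ : ℕ → OrderedField.Carrier K) →
    let open FiniteCoxeterSystem C
        open CoxeterGroup C
        open RootSystem C K cosπ/ using (_≤_)
        open Recursion C K cosπ/
    in
    (∀ {i j} → i ≢ j → Cosine.IsCosπ/ K (m i j) (cosπ/ (m i j))) →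
    Σ (Op₂ Carrier) λ _∨_ → Supremum _≤_ _∨_ ×
      ((≺ : (k : Fin n) → Rel (Rep k) r) → (∀ k → IsLinearExtension k (≺ k)) →
       (u w : Carrier) (uₖ wₖ : Fin (suc n) → Carrier) →
       (∀ k → IsProjection (Initial k) u (uₖ k)) →
       (∀ k → IsProjection (Initial k) w (wₖ k)) →
       (∃[ j ] ∃[ z ] IsRun ≺ uₖ wₖ j z) ×
       (∀ j z → IsRun ≺ uₖ wₖ j z →
          (∀ k → IsProjection (Initial k) (u ∨ w) (j k)) × j (fromℕ n) ≈ (u ∨ w)))
mainTheorem5 n C K cosπ/ isCosπ/ = _∨_ , ∨-supremum , λ ≺ extension u w uₖ wₖ u-proj w-proj →
  run-exists extension u-proj w-proj ,
  λ j z run → run-projects extension u-proj w-proj run ,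
              projection-all Initial-fromℕ (run-projects extension u-proj w-proj run (fromℕ n))
  where
  open JoinRecursion C K cosπ/ isCosπ/
  open WeakOrder C K cosπ/ isCosπ/ using (projection-all)
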